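{- Let $\mathcal M$ be an elementary extension of the $\mathcal L$-structure $\mathcal Z$, expanded to an $\mathcal L_P$-structure by interpreting the new unary predicate $P$ as an additively random subset $D$ of $M$ which is symmetric ($a\in D\iff -a\in D$). Then the $\mathcal L_P$-theory of $(\mathcal M,D)$ is supersimple of rank $1$: working in a sufficiently saturated model $\mathbb U$ of this theory, every $\mathcal L_P$-formula $\varphi(x,\bar a)$ in a single variable $x$ which divides over a subset $B\subseteq\mathbb U$ is algebraic (has only finitely many realizations).
   Context: $\mathcal L$ is the language of abelian groups $(+,-,0)$ with a constant $1$ and unary predicates $x\equiv_k j$ ($0\le j<k$); $\mathcal Z$ is $\mathbb Z$ with the natural interpretation (congruence modulo $k$); $\mathcal L_P=\mathcal L\cup\{P\}$. A formula $\varphi(x,\bar a)$ divides over $B$ if there is a $B$-indiscernible sequence $(\bar a_n)_{n\in\mathbb N}$ with $\bar a_0=\bar a$ such that $\{\varphi(x,\bar a_n)\}_{n\in\mathbb N}$ is inconsistent. A subset $D\subseteq M$ is additively random if for all $r,r'\in\mathbb N$ and all terms $m_1x+z_1,\ldots,m_rx+z_r$ and $m'_1x+z'_1,\ldots,m'_{r'}x+z'_{r'}$ with all $m_i,m'_j\ge1$ integers, there are an $\mathcal L$-formula $\chi(\bar z,\bar z')$ and a finite set $\partial(\chi)\subseteq\mathbb Z$ such that, for all tuples $\bar b,\bar b'$ in $M$ with $(m_i,b_i)\ne(m'_j,b'_j)$ for all $i,j$: (P1) if $\mathcal M\models\chi(\bar b,\bar b')$ then there are infinitely many $a\in M$ with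 $m_ia+b_i\in D$ for all $i$ and $m'_ja+b'_j\notin D$ for all $j$; (P2) if $\mathcal M\not\models\chi(\bar b,\bar b')$, then $r\ge1$ and there is $k\in\partial(\chi)$ such that for every integer $s\in\{0,\ldots,k-1\}$ some $m_is+b_i\equiv_k0$ (as a first-order statement: $\mathcal M\models\forall\bar y\bar y'((\neg\chi(\bar y,\bar y')\wedge\bigwedge_{i,j}y_i\ne y'_j)\to\bigvee_{k\in\partial(\chi)}\bigwedge_{s<k}\bigvee_{i=1}^r m_is+y_i\equiv_k0))$; (P3) for every $k\in\partial(\chi)$, the set of $x\in D$ with $x\equiv_k0$ is a finite subset of $\mathbb Z$. -}

module Defs where

open import Data.Fin.Base as Fin using (Fin; zero; suc; toℕ)
open import Data.Integer.Base as ℤ using (ℤ; +_; +[1+_])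
open import Data.Integer.Divisibility as ℤ using ()
open import Data.List.Base using (List)
open import Data.List.Membership.Propositional using (_∈_)
open import Data.List.Relation.Unary.All using (All)
open import Data.List.Relation.Unary.Any using (Any)
open import Data.Nat.Base as ℕ using (ℕ; zero; suc)
open import Data.Empty.Polymorphic using (⊥)
open import Data.Product.Base using (Σ-syntax; ∃-syntax; _×_; _,_)
open import Data.Vec.Functional using (Vector; []; _∷_; _++_; concat)
open import Function.Base using (_∘_)
open import Function.Bundles using (_⇔_)
open import Level using (Level; 0ℓ) renaming (_⊔_ to _⊔ˡ_; suc to lsuc)
open import Relation.Binary.Bundles using (Setoid)
open import Relation.Binary.Definitions using (_Respects_)
open import Relation.Binary.PropositionalEquality as ≡ using (_≡_)
open import Relation.Nullary.Negation.Core using (¬_)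
open import Relation.Unary using (Pred)

private
  variable
    ℓ ℓ′ : Level
    n : ℕ

record Language : Set₁ where
  field
    Fun : ℕ → Set
    Rel : ℕ → Set

open Language

data Term (L : Language) (n : ℕ) : Set where
  var : Fin n → Term L n
  app : ∀ {k} → Fun L k → Vector (Term L n) k → Term L n

-- Variables are de Bruijn indices: `all` binds index zero.  The remaining
-- connectives are the usual classical abbreviations.
data Formula (L : Language) : ℕ → Set where
  equal : Term L n → Term L n → Formula L n
  rel   : ∀ {k} → Rel L k → Vector (Term L n) k → Formula L n
  false : Formula L n
  imp   : Formula L n → Formula L n → Formula L n
  all   : Formula L (suc n) → Formula L n

Sentence : Language → Set
Sentence L = Formula L 0

-- Agda has no quotients, so the underlying set of a structure is a setoid,
-- and its equality interprets the equality symbol.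
record Structure (L : Language) (ℓ : Level) : Set (lsuc ℓ) where
  field
    setoid : Setoid ℓ ℓ

  open Setoid setoid public using (Carrier; _≈_)

  field
    fun      : ∀ {k} → Fun L k → Vector Carrier k → Carrier
    fun-cong : ∀ {k} (f : Fun L k) {xs ys : Vector Carrier k} →
               (∀ i → xs i ≈ ys i) → fun f xs ≈ fun f ys
    holds      : ∀ {k} → Rel L k → Vector Carrier k → Set ℓ
    holds-cong : ∀ {k} (R : Rel L k) {xs ys : Vector Carrier k} →
                 (∀ i → xs i ≈ ys i) → holds R xs → holds R ys

open Structure using (Carrier)

module _ {L : Language} (S : Structure L ℓ) where
  open Structure S using (_≈_; fun; holds)

  eval : Vector (Carrier S) n → Term L n → Carrier S
  eval v (var i)    = v i
  eval v (app f ts) = fun f (λ i → eval v (ts i))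

  infix 4 _⊨_[_]

  _⊨_[_] : Formula L n → Vector (Carrier S) n → Set ℓ
  _⊨_[_] (equal s t) v = eval v s ≈ eval v t
  _⊨_[_] (rel R ts)  v = holds R (λ i → eval v (ts i))
  _⊨_[_] false       v = ⊥
  _⊨_[_] (imp φ ψ)   v = _⊨_[_] φ v → _⊨_[_] ψ v
  _⊨_[_] (all φ)     v = ∀ c → _⊨_[_] φ (c ∷ v)

  Th : Pred (Sentence L) ℓ
  Th σ = _⊨_[_] σ []

  IsModelOf : Pred (Sentence L) ℓ′ → Set (ℓ ⊔ˡ ℓ′)
  IsModelOf T = ∀ σ → T σ → _⊨_[_] σ []

  IsFinite : Pred (Carrier S) ℓ → Set ℓ
  IsFinite X = ∃[ xs ] (∀ x → X x → Any (x ≈_) xs)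

  IsInfinite : Pred (Carrier S) ℓ → Set ℓ
  IsInfinite X = ¬ IsFinite X

record ElementaryEmbedding {L : Language} (S : Structure L ℓ)
                           (S′ : Structure L ℓ′) : Set (ℓ ⊔ˡ ℓ′) where
  field
    embed      : Carrier S → Carrier S′
    elementary : ∀ {n} (φ : Formula L n) (v : Vector (Carrier S) n) →
                 S ⊨ φ [ v ] ⇔ S′ ⊨ φ [ embed ∘ v ]

StrictlyIncreasing : ∀ {k} → Vector ℕ k → Set
StrictlyIncreasing i = ∀ {s t} → s Fin.< t → i s ℕ.< i t

module _ {L : Language} (U : Structure L ℓ) where
  open Structure U using (_≈_)

  -- Every set of formulas in one variable, with parameters from the countable
  -- set { e i | i ∈ ℕ }, that is finitely satisfiable in U is realized in U.
  -- An element (n , ψ , is) of p stands for the formula ψ(x, e(is 0), …).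
  ℵ₁-Saturated : Set (lsuc ℓ)
  ℵ₁-Saturated =
    (e : ℕ → Carrier U)
    (p : Pred (Σ[ n ∈ ℕ ] (Formula L (suc n) × Vector ℕ n)) ℓ) →
    let Realizes : Carrier U → Pred (Σ[ n ∈ ℕ ] (Formula L (suc n) × Vector ℕ n)) ℓ
        Realizes c (_ , ψ , is) = U ⊨ ψ [ c ∷ e ∘ is ]
    in (∀ qs → All p qs → ∃[ c ] All (Realizes c) qs) →
       ∃[ c ] (∀ q → p q → Realizes c q)

  Indiscernible : Pred (Carrier U) ℓ → ∀ {m} → (ℕ → Vector (Carrier U) m) → Set ℓ
  Indiscernible B {m} a =
    ∀ {k q} (ψ : Formula L (k ℕ.* m ℕ.+ q)) (b : Vector (Carrier U) q) →
    (∀ t → B (b t)) →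
    (i j : Vector ℕ k) → StrictlyIncreasing i → StrictlyIncreasing j →
    U ⊨ ψ [ concat (a ∘ i) ++ b ] ⇔ U ⊨ ψ [ concat (a ∘ j) ++ b ]

  -- Index zero of φ is the variable x, the other indices stand for ā.
  -- U plays the role of the monster model: a set of formulas over countably
  -- many parameters is inconsistent when no element of U realizes it.
  Divides : Pred (Carrier U) ℓ → ∀ {m} → Formula L (suc m) → Vector (Carrier U) m → Set ℓ
  Divides B {m} φ ā =
    Σ[ a ∈ (ℕ → Vector (Carrier U) m) ]
      Indiscernible B a ×
      (∀ t → a 0 t ≈ ā t) ×
      ¬ (∃[ c ] (∀ n → U ⊨ φ [ c ∷ a n ]))

  Algebraic : ∀ {m} → Formula L (suc m) → Vector (Carrier U) m → Set ℓ
  Algebraic φ ā = IsFinite U (λ c → U ⊨ φ [ c ∷ ā ])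

-- ℵ₁-saturation is the weakest reading of "sufficiently saturated" (the
-- languages used here are countable); more saturated models are included.
SupersimpleOfRank1 : {L : Language} (ℓ′ : Level) → Pred (Sentence L) ℓ → Set (ℓ ⊔ˡ lsuc ℓ′)
SupersimpleOfRank1 {L = L} ℓ′ T =
  (U : Structure L ℓ′) → IsModelOf U T → ℵ₁-Saturated U →
  ∀ {m} (φ : Formula L (suc m)) (ā : Vector (Carrier U) m) (B : Pred (Carrier U) ℓ′) →
  Divides U B φ ā → Algebraic U φ ā

data 𝓛-Fun : ℕ → Set where
  zeroᶠ oneᶠ : 𝓛-Fun 0
  negᶠ       : 𝓛-Fun 1
  addᶠ       : 𝓛-Fun 2

-- congᴿ k j is the predicate x ≡ₖ j; the type Fin k encodes 0 ≤ j < k.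
data 𝓛-Rel : ℕ → Set where
  congᴿ : (k : ℕ) → Fin k → 𝓛-Rel 1

data 𝓛ₚ-Rel : ℕ → Set where
  base : ∀ {k} → 𝓛-Rel k → 𝓛ₚ-Rel k
  P    : 𝓛ₚ-Rel 1

𝓛 : Language
𝓛 = record { Fun = 𝓛-Fun ; Rel = 𝓛-Rel }

𝓛ₚ : Language
𝓛ₚ = record { Fun = 𝓛-Fun ; Rel = 𝓛ₚ-Rel }

𝒵 : Structure 𝓛 0ℓ
𝒵 = record
  { setoid     = ≡.setoid ℤ
  ; fun        = fun
  ; fun-cong   = fun-cong
  ; holds      = holds
  ; holds-cong = λ { (congᴿ k j) xs≡ys →
                     ≡.subst (λ x → + k ℤ.∣ x ℤ.- + toℕ j) (xs≡ys zero) }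
  }
  where
  fun : ∀ {k} → 𝓛-Fun k → Vector ℤ k → ℤ
  fun zeroᶠ xs = + 0
  fun oneᶠ  xs = + 1
  fun negᶠ  xs = ℤ.- xs zero
  fun addᶠ  xs = xs zero ℤ.+ xs (suc zero)

  fun-cong : ∀ {k} (f : 𝓛-Fun k) {xs ys : Vector ℤ k} →
             (∀ i → xs i ≡ ys i) → fun f xs ≡ fun f ys
  fun-cong zeroᶠ xs≡ys = ≡.refl
  fun-cong oneᶠ  xs≡ys = ≡.refl
  fun-cong negᶠ  xs≡ys = ≡.cong ℤ.-_ (xs≡ys zero)
  fun-cong addᶠ  xs≡ys = ≡.cong₂ ℤ._+_ (xs≡ys zero) (xs≡ys (suc zero))

  holds : ∀ {k} → 𝓛-Rel k → Vector ℤ k → Set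
  holds (congᴿ k j) xs = + k ℤ.∣ xs zero ℤ.- + toℕ j

expand : (M : Structure 𝓛 ℓ) (D : Pred (Carrier M) ℓ) →
         D Respects (Structure._≈_ M) → Structure 𝓛ₚ ℓ
expand {ℓ} M D D-resp = record
  { setoid     = M.setoid
  ; fun        = M.fun
  ; fun-cong   = M.fun-cong
  ; holds      = holds
  ; holds-cong = λ { (base R) xs≈ys → M.holds-cong R xs≈ys
                   ; P        xs≈ys → D-resp (xs≈ys zero) }
  }
  where
  module M = Structure M

  holds : ∀ {k} → 𝓛ₚ-Rel k → Vector M.Carrier k → Set ℓ
  holds (base R) xs = M.holds R xs
  holds P        xs = D (xs zero)

module _ (M : Structure 𝓛 ℓ) where
  open Structure M using (_≈_; fun; holds)

  neg : Carrier M → Carrier M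
  neg a = fun negᶠ (a ∷ [])

  add : Carrier M → Carrier M → Carrier M
  add a b = fun addᶠ (a ∷ b ∷ [])

  mult : ℕ → Carrier M → Carrier M
  mult zero    a = fun zeroᶠ []
  mult (suc m) a = add a (mult m a)

  linear : ℕ → Carrier M → Carrier M → Carrier M
  linear m a b = add (mult m a) b

  -- x ≡ₖ 0 for the modulus k = suc k-1.
  DivisibleBySuc : ℕ → Carrier M → Set ℓ
  DivisibleBySuc k-1 x = holds (congᴿ (suc k-1) zero) (x ∷ [])

  SymmetricSubset : Pred (Carrier M) ℓ → Set ℓ
  SymmetricSubset D = ∀ a → D a ⇔ D (neg a)

  -- Only the positive members k = +[1+ k-1 ] of ∂ are used: 𝓛 has x ≡ₖ 0 only
  -- for k ≥ 1, and for k ≤ 0 the range { 0, …, k-1 } in P2 would be empty.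
  record AdditivelyRandomWitness
      (ι : ElementaryEmbedding 𝒵 M) (D : Pred (Carrier M) ℓ)
      {r r′ : ℕ} (m : Vector ℕ r) (m′ : Vector ℕ r′) : Set ℓ where
    open ElementaryEmbedding ι using (embed)

    Distinct : Vector (Carrier M) r → Vector (Carrier M) r′ → Set ℓ
    Distinct b b′ = ∀ i j → ¬ (m i ≡ m′ j × b i ≈ b′ j)

    field
      χ : Formula 𝓛 (r ℕ.+ r′)
      ∂ : List ℤ
      P1 : ∀ b b′ → Distinct b b′ → M ⊨ χ [ b ++ b′ ] →
           IsInfinite M (λ a → (∀ i → D (linear (m i) a (b i))) ×
                               (∀ j → ¬ D (linear (m′ j) a (b′ j))))
      P2 : ∀ b b′ → Distinct b b′ → ¬ (M ⊨ χ [ b ++ b′ ]) →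
           1 ℕ.≤ r ×
           ∃[ k-1 ] (+[1+ k-1 ] ∈ ∂ ×
             (∀ s → s ℕ.< suc k-1 →
                ∃[ i ] DivisibleBySuc k-1 (linear (m i) (embed (+ s)) (b i))))
      P3 : ∀ k-1 → +[1+ k-1 ] ∈ ∂ →
           ∃[ zs ] (∀ x → D x → DivisibleBySuc k-1 x → Any (λ z → x ≈ embed z) zs)

  AdditivelyRandom : ElementaryEmbedding 𝒵 M → Pred (Carrier M) ℓ → Set ℓ
  AdditivelyRandom ι D =
    ∀ {r r′} (m : Vector ℕ r) (m′ : Vector ℕ r′) →
    (∀ i → 1 ℕ.≤ m i) → (∀ j → 1 ℕ.≤ m′ j) →
    AdditivelyRandomWitness ι D m m′

{-# OPTIONS --safe #-}
-- Let φ(x, a₀) be non-algebraic and (aᵢ) indiscernible.  Call two tuples u ∼ w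
-- when they satisfy the same conditions t = 0, l ∣ t and t ∈ l P, for t a term.
-- If c is not in the divisible hull of (1, a₀), there is c′ with
-- (c, a₀) ∼ (c′, aᵢ) for all i: by saturation finitely many conditions suffice,
-- and after the substitution c = L y + j they ask that certain m y + b be in P
-- and others not.  Indiscernibility makes the images of the b's distinct where
-- they have to be, and additive randomness then provides y′; the obstruction in
-- (P2) only involves congruences, so it would already be present at a₀ and force
-- some m y + b into P ∩ kU, which is a finite set of integers.  The same
-- extension property for constant sequences is a back-and-forth argument showing
-- that ∼ preserves all formulas, so c′ realizes every φ(x, aᵢ).
module Submission where

open import Defs
open import Algebra.Bundles using (AbelianGroup; RawMonoid)
open import Algebra.Consequences.Setoid using (comm∧idˡ⇒id; comm∧invˡ⇒inv)
import Algebra.Definitions.RawMonoid as RawMonoid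
import Algebra.Properties.AbelianGroup
import Algebra.Properties.CommutativeMonoid.Mult
import Algebra.Properties.CommutativeSemigroup
open import Algebra.Structures using (IsAbelianGroup)
open import Axiom.ExcludedMiddle using (ExcludedMiddle)
open import Data.Bool.Base using (Bool; true; false)
open import Data.Empty using (⊥-elim)
open import Data.Fin.Base using (Fin; zero; suc; toℕ; fromℕ<; _↑ˡ_; _↑ʳ_; combine)
open import Data.Fin.Properties using (toℕ-injective; toℕ-fromℕ<; toℕ<n; remQuot-combine)
open import Data.Integer.Base as ℤ using (ℤ; +_; -[1+_]; +[1+_])
open import Data.Integer.DivMod using (_/ℕ_; _%ℕ_; a≡a%ℕn+[a/ℕn]*n; n%ℕd<d)
open import Data.Integer.Divisibility.Signed using (∣ᵤ⇒∣; ∣⇒∣ᵤ; divides)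
import Data.Integer.Properties as ℤ
open import Data.List.Base as List using (List; lookup; map) renaming ([] to []ᴸ; _∷_ to infixr 5 _∷ᴸ_)
open import Data.List.Membership.Propositional using (_∈_)
open import Data.List.Membership.Propositional.Properties using (∈-lookup)
open import Data.List.Relation.Unary.All as All using (All) renaming ([] to []ᴸ; _∷_ to infixr 5 _∷ᴸ_)
open import Data.List.Relation.Unary.Any as Any using (Any; here; there)
import Data.List.Relation.Unary.Any.Properties as Any
open import Data.Maybe.Base using (Maybe; just; nothing)
open import Data.Nat.Base as ℕ using (ℕ; zero; suc)
open import Data.Nat.Divisibility using (_∣_; divides; n∣m*n; m∣m*n; ∣n⇒∣m*n)
open import Data.Nat.DivMod using (_/_; _mod_; [m+kn]%n≡m%n; m<n⇒m%n≡m; +-distrib-/-∣ʳ; m<n⇒m/n≡0; m*n/n≡m)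
import Data.Nat.Properties as ℕ
open import Data.Product.Base using (Σ-syntax; ∃-syntax; _×_; _,_; proj₁; proj₂)
open import Data.Sum.Base using (_⊎_; inj₁; inj₂)
open import Data.Unit.Polymorphic using (⊤; tt)
open import Data.Vec.Functional using (Vector; []; _∷_; _++_; concat; head; tail)
open import Data.Vec.Functional.Properties using (lookup-++ˡ; lookup-++ʳ)
open import Function.Base using (_∘_; id)
open import Function.Bundles using (_⇔_; mk⇔; Equivalence)
open import Function.Construct.Composition using (_⇔-∘_)
open import Function.Construct.Symmetry using (⇔-sym)
open import Level using (Level; lift; lower)
open import Relation.Binary.Bundles using (Setoid)
open import Relation.Binary.Definitions using (_Respects_; tri<; tri≈; tri>)
open import Relation.Binary.PropositionalEquality as ≡ using (_≡_)
open import Relation.Nullary.Decidable.Core using (yes; no; decidable-stable)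
open import Relation.Nullary.Negation.Core using (¬_; contradiction)
open import Relation.Unary using (Pred)

open Equivalence using (to; from)

-- The kinds of condition are chosen to survive clearing denominators. They turn back into
-- conditions on P only when the modulus divides both the coefficient of the new element and the
-- remaining term; this is what the substitution c = L y + j is for. The main obstacle is that one
-- element has to serve all tuples of the sequence at once: a shift wanted in P on account of aᵢ
-- could coincide with a shift unwanted on account of aⱼ, and then neither (P1) nor (P2) would
-- apply. For this reason `Extension` assumes `coherent`, by which an equation between values at two
-- places of the sequence already holds at the starting tuple. The obstruction in (P2) can be
-- refuted because it speaks of every residue s: it may be read at the residue of y itself, where a
-- wanted shift is known to lie in P.

private
  variable
    ℓ ℓ′ : Level
    k n : ℕ
    L : Language
    R : ℕ → Set

-- First-order logic

module _ (S : Structure L ℓ) where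
  open Structure S
  open Setoid setoid using (refl; sym)

  ∷-cong : ∀ {x y} {v w : Vector Carrier n} → x ≈ y → (∀ i → v i ≈ w i) →
           ∀ i → (x ∷ v) i ≈ (y ∷ w) i
  ∷-cong x≈y v≈w zero    = x≈y
  ∷-cong x≈y v≈w (suc i) = v≈w i

  eval-cong : ∀ {v w : Vector Carrier n} → (∀ i → v i ≈ w i) →
              ∀ t → eval S v t ≈ eval S w t
  eval-cong v≈w (var i)    = v≈w i
  eval-cong v≈w (app f ts) = fun-cong f (λ i → eval-cong v≈w (ts i))

  -- Environments are functions, so two descriptions of one tuple, such as `v` and
  -- `head v ∷ tail v`, agree only pointwise; this lemma exchanges them.
  ⊨-cong : ∀ {v w : Vector Carrier n} → (∀ i → v i ≈ w i) →
           ∀ φ → S ⊨ φ [ v ] → S ⊨ φ [ w ]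
  ⊨-cong v≈w (equal s t) eq =
    Setoid.trans setoid (sym (eval-cong v≈w s)) (Setoid.trans setoid eq (eval-cong v≈w t))
  ⊨-cong v≈w (rel R ts)  = holds-cong R (λ i → eval-cong v≈w (ts i))
  ⊨-cong v≈w false       = λ ()
  ⊨-cong v≈w (imp φ ψ) h = ⊨-cong v≈w ψ ∘ h ∘ ⊨-cong (λ i → sym (v≈w i)) φ
  ⊨-cong v≈w (all φ) h c = ⊨-cong (∷-cong refl v≈w) φ (h c)

rename : (Fin k → Fin n) → Term L k → Term L n
rename ρ (var i)    = var (ρ i)
rename ρ (app f ts) = app f (λ i → rename ρ (ts i))

eval-rename : (S : Structure L ℓ) (ρ : Fin k → Fin n) (v : Vector (Structure.Carrier S) n) →
              ∀ t → Structure._≈_ S (eval S v (rename ρ t)) (eval S (v ∘ ρ) t)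
eval-rename S ρ v (var i)    = Setoid.refl (Structure.setoid S)
eval-rename S ρ v (app f ts) = Structure.fun-cong S f (λ i → eval-rename S ρ v (ts i))

not : Formula L n → Formula L n
not φ = imp φ false

and : Formula L n → Formula L n → Formula L n
and φ ψ = not (imp φ (not ψ))

or : Formula L n → Formula L n → Formula L n
or φ ψ = imp (not φ) ψ

ex : Formula L (suc n) → Formula L n
ex φ = not (all (not φ))

⋁ : Vector (Formula L n) k → Formula L n
⋁ {k = zero}  φs = false
⋁ {k = suc k} φs = or (head φs) (⋁ (tail φs))

⋀ : Vector (Formula L n) k → Formula L n
⋀ {k = zero}  φs = not false
⋀ {k = suc k} φs = and (head φs) (⋀ (tail φs))

-- `IsModelOf` tests sentences only, so axioms with free variables are transferred in closed form.
closure : Formula L n → Sentence L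
closure {n = zero}  φ = φ
closure {n = suc n} φ = closure (all φ)

module _ (S : Structure L ℓ) where
  open Structure S
  open Setoid setoid using (refl)

  closure-to : ∀ (φ : Formula L n) → S ⊨ closure φ [ [] ] → ∀ v → S ⊨ φ [ v ]
  closure-to {n = zero}  φ h v = ⊨-cong S (λ ()) φ h
  closure-to {n = suc n} φ h v =
    ⊨-cong S (λ { zero → refl ; (suc i) → refl }) φ
           (closure-to (all φ) h (tail v) (head v))

  closure-from : ∀ (φ : Formula L n) → (∀ v → S ⊨ φ [ v ]) → S ⊨ closure φ [ [] ]
  closure-from {n = zero}  φ h = h []
  closure-from {n = suc n} φ h = closure-from (all φ) (λ v c → h (c ∷ v))

-- Classical reading of the derived connectives

module Classical (em : ∀ {a} → ExcludedMiddle a) where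

  by-contradiction : {A : Set ℓ} → ¬ ¬ A → A
  by-contradiction = decidable-stable em

  module _ (S : Structure L ℓ) {v : Vector (Structure.Carrier S) n} where

    ⊨-not : ∀ φ → S ⊨ not φ [ v ] ⇔ (¬ S ⊨ φ [ v ])
    ⊨-not φ = mk⇔ (λ h x → lower (h x)) (λ h x → lift (h x))

    ⊨-and : ∀ φ ψ → S ⊨ and φ ψ [ v ] ⇔ (S ⊨ φ [ v ] × S ⊨ ψ [ v ])
    ⊨-and φ ψ = mk⇔
      (λ h → by-contradiction (λ ¬xy → lower (h (λ x → lift ∘ λ y → ¬xy (x , y)))))
      (λ (x , y) h → h x y)

    ⊨-or : ∀ φ ψ → S ⊨ or φ ψ [ v ] ⇔ (S ⊨ φ [ v ] ⊎ S ⊨ ψ [ v ])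
    ⊨-or φ ψ = mk⇔
      (λ h → by-contradiction (λ ¬xy → ¬xy (inj₂ (h (lift ∘ ¬xy ∘ inj₁)))))
      (λ { (inj₁ x) ¬x → ⊥-elim (lower (¬x x)) ; (inj₂ y) _ → y })

    ⊨-ex : ∀ φ → S ⊨ ex φ [ v ] ⇔ (∃[ c ] S ⊨ φ [ c ∷ v ])
    ⊨-ex φ = mk⇔
      (λ h → by-contradiction (λ ¬x → lower (h (λ c x → lift (¬x (c , x))))))
      (λ (c , x) h → h c x)

    ⊨-⋁ : ∀ (φs : Vector (Formula L n) k) → S ⊨ ⋁ φs [ v ] ⇔ (∃[ i ] S ⊨ φs i [ v ])
    ⊨-⋁ {k = zero}  φs = mk⇔ (λ ()) (λ ())
    ⊨-⋁ {k = suc k} φs = mk⇔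
      (λ h → case-or (to disjunction h))
      (λ { (zero , x)  → from disjunction (inj₁ x)
         ; (suc i , x) → from disjunction (inj₂ (from (⊨-⋁ (tail φs)) (i , x))) })
      where
      disjunction = ⊨-or (head φs) (⋁ (tail φs))

      case-or : S ⊨ head φs [ v ] ⊎ S ⊨ ⋁ (tail φs) [ v ] → ∃[ i ] S ⊨ φs i [ v ]
      case-or (inj₁ x) = zero , x
      case-or (inj₂ h) = let i , x = to (⊨-⋁ (tail φs)) h in suc i , x

    ⊨-⋀ : ∀ (φs : Vector (Formula L n) k) → S ⊨ ⋀ φs [ v ] ⇔ (∀ i → S ⊨ φs i [ v ])
    ⊨-⋀ {k = zero}  φs = mk⇔ (λ _ ()) (λ _ x → x)
    ⊨-⋀ {k = suc k} φs = mk⇔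
      (λ { h zero    → proj₁ (to conjunction h)
         ; h (suc i) → to (⊨-⋀ (tail φs)) (proj₂ (to conjunction h)) i })
      (λ h → from conjunction (h zero , from (⊨-⋀ (tail φs)) (h ∘ suc)))
      where
      conjunction = ⊨-and (head φs) (⋀ (tail φs))

-- Arithmetic formulas in the language with P

termₚ : Term 𝓛 n → Term 𝓛ₚ n
termₚ (var i)    = var i
termₚ (app f ts) = app f (λ i → termₚ (ts i))

formulaₚ : Formula 𝓛 n → Formula 𝓛ₚ n
formulaₚ (equal s t) = equal (termₚ s) (termₚ t)
formulaₚ (rel R ts)  = rel (base R) (λ i → termₚ (ts i))
formulaₚ false       = false
formulaₚ (imp φ ψ)   = imp (formulaₚ φ) (formulaₚ ψ)
formulaₚ (all φ)     = all (formulaₚ φ)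

reduct : Structure 𝓛ₚ ℓ → Structure 𝓛 ℓ
reduct S = record
  { setoid     = S.setoid
  ; fun        = S.fun
  ; fun-cong   = S.fun-cong
  ; holds      = λ R → S.holds (base R)
  ; holds-cong = λ R → S.holds-cong (base R)
  }
  where module S = Structure S

module _ (S : Structure 𝓛ₚ ℓ) where
  open Structure S
  open Setoid setoid using (refl; sym; trans)

  eval-termₚ : ∀ (v : Vector Carrier n) t → eval S v (termₚ t) ≈ eval (reduct S) v t
  eval-termₚ v (var i)    = refl
  eval-termₚ v (app f ts) = fun-cong f (λ i → eval-termₚ v (ts i))

  ⊨-formulaₚ : ∀ (v : Vector Carrier n) φ → S ⊨ formulaₚ φ [ v ] ⇔ reduct S ⊨ φ [ v ]
  ⊨-formulaₚ v (equal s t) = mk⇔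
    (λ eq → trans (sym (eval-termₚ v s)) (trans eq (eval-termₚ v t)))
    (λ eq → trans (eval-termₚ v s) (trans eq (sym (eval-termₚ v t))))
  ⊨-formulaₚ v (rel R ts) = mk⇔
    (holds-cong (base R) (λ i → eval-termₚ v (ts i)))
    (holds-cong (base R) (λ i → sym (eval-termₚ v (ts i))))
  ⊨-formulaₚ v false = mk⇔ (λ x → x) (λ x → x)
  ⊨-formulaₚ v (imp φ ψ) = mk⇔
    (λ h → to (⊨-formulaₚ v ψ) ∘ h ∘ from (⊨-formulaₚ v φ))
    (λ h → from (⊨-formulaₚ v ψ) ∘ h ∘ to (⊨-formulaₚ v φ))
  ⊨-formulaₚ v (all φ) = mk⇔
    (λ h c → to (⊨-formulaₚ (c ∷ v) φ) (h c))
    (λ h c → from (⊨-formulaₚ (c ∷ v) φ) (h c))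

-- Saturation for indexed families of formulas

module _ {L : Language} (U : Structure L ℓ) (saturated : ℵ₁-Saturated U) where
  open Structure U

  -- `ℵ₁-Saturated` takes its parameters from a single sequence of elements. Here each formula uses
  -- one of countably many tuples, so the tuples are packed into one sequence and each index is
  -- turned into a formula with a list of positions.
  saturated-family :
    {I : Set} (v : ℕ → Vector Carrier n) (ν : I → ℕ) (θ : I → Formula L (suc n)) (p : Pred I ℓ) →
    (∀ is → All p is → ∃[ c ] All (λ i → U ⊨ θ i [ c ∷ v (ν i) ]) is) →
    Carrier →
    ∃[ c ] (∀ i → p i → U ⊨ θ i [ c ∷ v (ν i) ])
  saturated-family {n = n} {I = I} v ν θ p finitely-satisfiable x₀ =
    let c , h = saturated e p̂ satisfy
    in c , λ i pi → ⊨-cong U (env c i) (θ i) (h (code i) (i , pi , ≡.refl))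
    where
    open Setoid setoid using (refl; reflexive; sym)

    -- The entry v q t is stored at position (t + 1) + q (n + 1); the multiples
    -- of n + 1 hold the dummy x₀, so that n = 0 needs no special treatment.
    e : ℕ → Carrier
    e j = (x₀ ∷ v (j / suc n)) (j mod suc n)

    position : I → Fin n → ℕ
    position i t = toℕ (suc t) ℕ.+ ν i ℕ.* suc n

    position-mod : ∀ i t → position i t mod suc n ≡ suc t
    position-mod i t = toℕ-injective (≡.trans (toℕ-fromℕ< _)
      (≡.trans ([m+kn]%n≡m%n (toℕ (suc t)) (ν i) (suc n)) (m<n⇒m%n≡m (toℕ<n (suc t)))))

    position-/ : ∀ i t → position i t / suc n ≡ ν i
    position-/ i t = ≡.trans (+-distrib-/-∣ʳ (toℕ (suc t)) (n∣m*n (ν i) {suc n}))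
      (≡.cong₂ ℕ._+_ (m<n⇒m/n≡0 (toℕ<n (suc t))) (m*n/n≡m (ν i) (suc n)))

    e-position : ∀ i t → e (position i t) ≡ v (ν i) t
    e-position i t rewrite position-mod i t | position-/ i t = ≡.refl

    Code : Set
    Code = Σ[ n ∈ ℕ ] (Formula L (suc n) × Vector ℕ n)

    code : I → Code
    code i = n , θ i , position i

    p̂ : Pred Code ℓ
    p̂ q = ∃[ i ] (p i × q ≡ code i)

    env : ∀ c i t → (c ∷ e ∘ position i) t ≈ (c ∷ v (ν i)) t
    env c i = ∷-cong U refl (λ t → reflexive (e-position i t))

    indices : ∀ {qs} → All p̂ qs → List I
    indices []ᴸ              = []ᴸ
    indices ((i , _) ∷ᴸ pqs) = i ∷ᴸ indices pqs

    indices-p : ∀ {qs} (pqs : All p̂ qs) → All p (indices pqs)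
    indices-p []ᴸ                   = []ᴸ
    indices-p ((i , pi , _) ∷ᴸ pqs) = pi ∷ᴸ indices-p pqs

    Realizes : Carrier → Pred Code ℓ
    Realizes c (_ , ψ , is) = U ⊨ ψ [ c ∷ e ∘ is ]

    realize : ∀ {c qs} (pqs : All p̂ qs) →
              All (λ i → U ⊨ θ i [ c ∷ v (ν i) ]) (indices pqs) → All (Realizes c) qs
    realize []ᴸ []ᴸ = []ᴸ
    realize {c} ((i , _ , ≡.refl) ∷ᴸ pqs) (h ∷ᴸ hs) =
      ⊨-cong U (λ t → sym (env c i t)) (θ i) h ∷ᴸ realize pqs hs

    satisfy : ∀ qs → All p̂ qs → ∃[ c ] All (Realizes c) qs
    satisfy qs pqs =
      let c , hs = finitely-satisfiable (indices pqs) (indices-p pqs)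
      in c , realize pqs hs

-- Arithmetic terms and axioms

-- Leaving the relation symbols open makes the same terms and evaluation lemmas serve both `𝓛` and
-- `𝓛ₚ`, which are instances.
arithmetic : (ℕ → Set) → Language
arithmetic R = record { Fun = 𝓛-Fun ; Rel = R }

infixl 6 _⊕_
infixr 7 _⊙_
infix  8 ⊖_

𝟘 𝟙 : Term (arithmetic R) n
𝟘 = app zeroᶠ []
𝟙 = app oneᶠ []

⊖_ : Term (arithmetic R) n → Term (arithmetic R) n
⊖ t = app negᶠ (t ∷ [])

_⊕_ : Term (arithmetic R) n → Term (arithmetic R) n → Term (arithmetic R) n
s ⊕ t = app addᶠ (s ∷ t ∷ [])

_⊙_ : ℕ → Term (arithmetic R) n → Term (arithmetic R) n
zero  ⊙ t = 𝟘
suc k ⊙ t = t ⊕ k ⊙ t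

numeral : ℤ → Term (arithmetic R) n
numeral (+ k)    = k ⊙ 𝟙
numeral -[1+ k ] = ⊖ (suc k ⊙ 𝟙)

module Arithmetic (S : Structure (arithmetic R) ℓ) where
  open Structure S public
  open Setoid setoid public using (refl; sym; trans; reflexive; isEquivalence)

  infixl 6 _+_
  infixr 8 _·_
  infix  9 -_

  0# 1# : Carrier
  0# = fun zeroᶠ []
  1# = fun oneᶠ []

  -_ : Carrier → Carrier
  - x = fun negᶠ (x ∷ [])

  _+_ : Carrier → Carrier → Carrier
  x + y = fun addᶠ (x ∷ y ∷ [])

  rawMonoid : RawMonoid ℓ ℓ
  rawMonoid = record { Carrier = Carrier ; _≈_ = _≈_ ; _∙_ = _+_ ; ε = 0# }

  -- Taken from the raw monoid, so that multiples make sense before any group law is known and the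
  -- general lemmas on multiples apply once the laws are proved.
  _·_ : ℕ → Carrier → Carrier
  _·_ = RawMonoid._×_ rawMonoid

  integer : ℤ → Carrier
  integer (+ k)    = k · 1#
  integer -[1+ k ] = - (suc k · 1#)

  neg-cong : ∀ {x y} → x ≈ y → - x ≈ - y
  neg-cong x≈y = fun-cong negᶠ (λ { zero → x≈y })

  +-cong : ∀ {x y z w} → x ≈ y → z ≈ w → x + z ≈ y + w
  +-cong x≈y z≈w = fun-cong addᶠ (λ { zero → x≈y ; (suc zero) → z≈w })

  ·-cong : ∀ k {x y} → x ≈ y → k · x ≈ k · y
  ·-cong zero    x≈y = refl
  ·-cong (suc k) x≈y = +-cong x≈y (·-cong k x≈y)

  module _ (v : Vector Carrier n) where

    -- This and its companions need `fun-cong`: evaluation composes with the vector of arguments,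
    -- and the result matches the literal vector only pointwise.
    eval-𝟘 : eval S v 𝟘 ≈ 0#
    eval-𝟘 = fun-cong zeroᶠ (λ ())

    eval-𝟙 : eval S v 𝟙 ≈ 1#
    eval-𝟙 = fun-cong oneᶠ (λ ())

    eval-⊖ : ∀ t → eval S v (⊖ t) ≈ - eval S v t
    eval-⊖ t = fun-cong negᶠ (λ { zero → refl })

    eval-⊕ : ∀ s t → eval S v (s ⊕ t) ≈ eval S v s + eval S v t
    eval-⊕ s t = fun-cong addᶠ (λ { zero → refl ; (suc zero) → refl })

    eval-⊙ : ∀ k t → eval S v (k ⊙ t) ≈ k · eval S v t
    eval-⊙ zero    t = eval-𝟘
    eval-⊙ (suc k) t = trans (eval-⊕ t (k ⊙ t)) (+-cong refl (eval-⊙ k t))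

    eval-⊙𝟙 : ∀ k → eval S v (k ⊙ 𝟙) ≈ k · 1#
    eval-⊙𝟙 k = trans (eval-⊙ k 𝟙) (·-cong k eval-𝟙)

    eval-⊙⊕ : ∀ k s t → eval S v (k ⊙ s ⊕ t) ≈ k · eval S v s + eval S v t
    eval-⊙⊕ k s t = trans (eval-⊕ (k ⊙ s) t) (+-cong (eval-⊙ k s) refl)

    eval-⊙⊕⊙𝟙 : ∀ k t j → eval S v (k ⊙ t ⊕ j ⊙ 𝟙) ≈ k · eval S v t + j · 1#
    eval-⊙⊕⊙𝟙 k t j = trans (eval-⊙⊕ k t (j ⊙ 𝟙)) (+-cong refl (eval-⊙𝟙 j))

    eval-numeral : ∀ z → eval S v (numeral z) ≈ integer z
    eval-numeral (+ k)    = eval-⊙𝟙 k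
    eval-numeral -[1+ k ] = trans (eval-⊖ (suc k ⊙ 𝟙)) (neg-cong (eval-⊙𝟙 (suc k)))

-- Elementary consequences of the theory; none of them mentions the formula χ
-- or its interpretation, which is why χ never has to be carried over to U.
record IsRandomGroup (U : Structure 𝓛ₚ ℓ) : Set ℓ where
  open Arithmetic U

  InP : Pred Carrier ℓ
  InP x = holds P (x ∷ [])

  -- Here and below k stands for the modulus k + 1, and in `random` the entries
  -- of m and m′ stand for the coefficients m i + 1 and m′ j + 1.
  Divisible : ℕ → Pred Carrier ℓ
  Divisible k x = ∃[ y ] x ≈ suc k · y

  field
    isAbelianGroup : IsAbelianGroup _≈_ _+_ 0# -_
    torsion-free   : ∀ k {x} → suc k · x ≈ 0# → x ≈ 0#
    division       : ∀ k x → ∃[ j ] (j ℕ.< suc k × ∃[ y ] x ≈ suc k · y + j · 1#)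
    congruence     : ∀ {k} (j : Fin k) x →
                     holds (base (congᴿ k j)) (x ∷ []) ⇔ (∃[ y ] x ≈ k · y + toℕ j · 1#)
    InP-neg        : ∀ {x} → InP x → InP (- x)
    random         :
      ∀ {r r′ q} (m : Vector ℕ r) (m′ : Vector ℕ r′)
      (b : Vector Carrier r) (b′ : Vector Carrier r′) (e : Vector Carrier q) →
      (∀ i j → ¬ (m i ≡ m′ j × b i ≈ b′ j)) →
      (∃[ y ] ((∀ l → ¬ y ≈ e l) × (∀ i → InP (suc (m i) · y + b i)) ×
               (∀ j → ¬ InP (suc (m′ j) · y + b′ j)))) ⊎
      (∃[ k ] ((∀ x → InP x → Divisible k x → ∃[ z ] x ≈ integer z) ×
               (∀ s → s ℕ.< suc k → ∃[ i ] Divisible k (suc (m i) · (s · 1#) + b i))))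

-- The arithmetic axioms in ℤ

module Integers where
  open Arithmetic 𝒵 using (_·_; integer)
  open import Relation.Binary.PropositionalEquality using (cong; cong₂; module ≡-Reasoning)
  open ≡-Reasoning

  ·≡* : ∀ k x → k · x ≡ + k ℤ.* x
  ·≡* zero    x = ≡.refl
  ·≡* (suc k) x = ≡.trans (cong (ℤ._+_ x) (·≡* k x)) (≡.sym (ℤ.suc-* (+ k) x))

  ·1≡ : ∀ k → k · (+ 1) ≡ + k
  ·1≡ k = ≡.trans (·≡* k (+ 1)) (ℤ.*-identityʳ (+ k))

  integer≡ : ∀ z → integer z ≡ z
  integer≡ (+ k)    = ·1≡ k
  integer≡ -[1+ k ] = cong ℤ.-_ (·1≡ (suc k))

  torsion-free : ∀ k x → suc k · x ≡ + 0 → x ≡ + 0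
  torsion-free k x eq with ℤ.i*j≡0⇒i≡0∨j≡0 (+ suc k) (≡.trans (≡.sym (·≡* (suc k) x)) eq)
  ... | inj₂ x≡0 = x≡0

  ·+·1≡ : ∀ k y j → k · y ℤ.+ j · (+ 1) ≡ + j ℤ.+ y ℤ.* + k
  ·+·1≡ k y j = begin
    k · y ℤ.+ j · (+ 1)  ≡⟨ cong₂ ℤ._+_ (·≡* k y) (·1≡ j) ⟩
    + k ℤ.* y ℤ.+ + j    ≡⟨ ℤ.+-comm (+ k ℤ.* y) (+ j) ⟩
    + j ℤ.+ + k ℤ.* y    ≡⟨ cong (ℤ._+_ (+ j)) (ℤ.*-comm (+ k) y) ⟩
    + j ℤ.+ y ℤ.* + k    ∎

  congruence-to : ∀ k (j : Fin k) x → Structure.holds 𝒵 (congᴿ k j) (x ∷ []) →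
                  ∃[ y ] x ≡ k · y ℤ.+ toℕ j · (+ 1)
  congruence-to k j x k∣x-j with ∣ᵤ⇒∣ {+ k} {x ℤ.- + toℕ j} k∣x-j
  ... | divides y eq = y , (begin
    x                                       ≡⟨ ℤ.+-identityʳ x ⟨
    x ℤ.+ + 0                               ≡⟨ cong (ℤ._+_ x) (ℤ.+-inverseˡ (+ toℕ j)) ⟨
    x ℤ.+ (ℤ.- + toℕ j ℤ.+ + toℕ j)         ≡⟨ ℤ.+-assoc x _ _ ⟨
    x ℤ.- + toℕ j ℤ.+ + toℕ j               ≡⟨ cong (ℤ._+ + toℕ j) eq ⟩
    y ℤ.* + k ℤ.+ + toℕ j                   ≡⟨ ℤ.+-comm (y ℤ.* + k) (+ toℕ j) ⟩
    + toℕ j ℤ.+ y ℤ.* + k                   ≡⟨ ·+·1≡ k y (toℕ j) ⟨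
    k · y ℤ.+ toℕ j · (+ 1)                 ∎)

  congruence-from : ∀ k (j : Fin k) x y → x ≡ k · y ℤ.+ toℕ j · (+ 1) →
                    Structure.holds 𝒵 (congᴿ k j) (x ∷ [])
  congruence-from k j x y eq = ∣⇒∣ᵤ {+ k} (divides y (begin
    x ℤ.- + toℕ j                                 ≡⟨ cong (ℤ._- + toℕ j) (≡.trans eq (·+·1≡ k y (toℕ j))) ⟩
    + toℕ j ℤ.+ y ℤ.* + k ℤ.- + toℕ j             ≡⟨ cong (ℤ._- + toℕ j) (ℤ.+-comm (+ toℕ j) (y ℤ.* + k)) ⟩
    y ℤ.* + k ℤ.+ + toℕ j ℤ.- + toℕ j             ≡⟨ ℤ.+-assoc (y ℤ.* + k) _ _ ⟩
    y ℤ.* + k ℤ.+ (+ toℕ j ℤ.- + toℕ j)           ≡⟨ cong (ℤ._+_ (y ℤ.* + k)) (ℤ.+-inverseʳ (+ toℕ j)) ⟩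
    y ℤ.* + k ℤ.+ + 0                             ≡⟨ ℤ.+-identityʳ _ ⟩
    y ℤ.* + k                                     ∎))

  division : ∀ k x → ∃[ y ] ∃[ j ] x ≡ suc k · y ℤ.+ toℕ {suc k} j · (+ 1)
  division k x = x /ℕ suc k , fromℕ< (n%ℕd<d x (suc k)) , (begin
    x                                                     ≡⟨ a≡a%ℕn+[a/ℕn]*n x (suc k) ⟩
    + (x %ℕ suc k) ℤ.+ (x /ℕ suc k) ℤ.* + suc k           ≡⟨ ·+·1≡ (suc k) (x /ℕ suc k) (x %ℕ suc k) ⟨
    suc k · (x /ℕ suc k) ℤ.+ (x %ℕ suc k) · (+ 1)
      ≡⟨ cong (λ j → suc k · (x /ℕ suc k) ℤ.+ j · (+ 1)) (toℕ-fromℕ< (n%ℕd<d x (suc k))) ⟨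
    suc k · (x /ℕ suc k) ℤ.+ toℕ (fromℕ< (n%ℕd<d x (suc k))) · (+ 1) ∎)

-- Additive randomness as a scheme of axioms

module _ {r r′ q : ℕ} (m : Vector ℕ r) (m′ : Vector ℕ r′)
         (β : Vector (Fin n) r) (β′ : Vector (Fin n) r′) (ε : Vector (Fin n) q) (∂ : List ℤ) where

  -- The coefficients are numbers outside the structure, so they are compared while the formula is
  -- being built.
  clash : Fin r → Fin r′ → Formula 𝓛ₚ n
  clash i j with m i ℕ.≟ m′ j
  ... | yes _ = equal (var (β i)) (var (β′ j))
  ... | no _  = false

  covered : ℤ → Formula 𝓛ₚ n
  covered +[1+ k ] = ⋀ λ (s : Fin (suc k)) → ⋁ λ i →
    rel (base (congᴿ (suc k) zero)) (suc (m i) ⊙ (toℕ s ⊙ 𝟙) ⊕ var (β i) ∷ [])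
  covered _ = false

  -- Avoiding the elements at `ε` is the first-order form of "infinitely many": one axiom for each
  -- number q of elements to avoid.
  pattern-instance : Formula 𝓛ₚ (suc n)
  pattern-instance =
    and (⋀ λ l → not (equal (var zero) (var (suc (ε l)))))
    (and (⋀ λ i → rel P (suc (m i) ⊙ var zero ⊕ var (suc (β i)) ∷ []))
         (⋀ λ j → not (rel P (suc (m′ j) ⊙ var zero ⊕ var (suc (β′ j)) ∷ []))))

  random-axiom : Formula 𝓛ₚ n
  random-axiom =
    or (⋁ λ i → ⋁ λ j → clash i j)
    (or (⋁ λ d → covered (lookup ∂ d)) (ex pattern-instance))

finite-axiom : ℕ → List ℤ → Formula 𝓛ₚ 1
finite-axiom k zs =
  imp (rel P (var zero ∷ []))
  (imp (rel (base (congᴿ (suc k) zero)) (var zero ∷ []))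
       (⋁ λ i → equal (var zero) (numeral (lookup zs i))))

module Axioms (em : ∀ {a} → ExcludedMiddle a) where
  open Classical em

  module _ (S : Structure 𝓛ₚ ℓ) where
    open Arithmetic S

    ⊨-P : ∀ (v : Vector Carrier n) t {x} → eval S v t ≈ x →
          S ⊨ rel P (t ∷ []) [ v ] ⇔ holds P (x ∷ [])
    ⊨-P v t eq = mk⇔ (holds-cong P (λ { zero → eq })) (holds-cong P (λ { zero → sym eq }))

    ⊨-cong-symbol : ∀ (j : Fin k) (v : Vector Carrier n) t {x} → eval S v t ≈ x →
          S ⊨ rel (base (congᴿ k j)) (t ∷ []) [ v ] ⇔ holds (base (congᴿ k j)) (x ∷ [])
    ⊨-cong-symbol j v t eq =
      mk⇔ (holds-cong (base (congᴿ _ j)) (λ { zero → eq }))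
          (holds-cong (base (congᴿ _ j)) (λ { zero → sym eq }))

    ⊨-finite-axiom : ∀ k zs v → S ⊨ finite-axiom k zs [ v ] ⇔
      (holds P (v zero ∷ []) → holds (base (congᴿ (suc k) zero)) (v zero ∷ []) →
       ∃[ i ] v zero ≈ integer (lookup zs i))
    ⊨-finite-axiom k zs v = mk⇔
      (λ h x∈P k∣x →
        let i , eq = to disjunction (h (from in-P x∈P) (from divisible k∣x))
        in i , trans eq (eval-numeral v (lookup zs i)))
      (λ h x∈P k∣x →
        let i , eq = h (to in-P x∈P) (to divisible k∣x)
        in from disjunction (i , trans eq (sym (eval-numeral v (lookup zs i)))))
      where
      in-P        = ⊨-P v (var zero) refl
      divisible   = ⊨-cong-symbol zero v (var zero) refl
      disjunction = ⊨-⋁ S {v} λ i → equal (var zero) (numeral (lookup zs i))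

    module _ {r r′ q : ℕ} (m : Vector ℕ r) (m′ : Vector ℕ r′)
             (β : Vector (Fin n) r) (β′ : Vector (Fin n) r′) (ε : Vector (Fin n) q)
             (∂ : List ℤ) (v : Vector Carrier n) where

      Clash : Fin r → Fin r′ → Set _
      Clash i j = m i ≡ m′ j × v (β i) ≈ v (β′ j)

      Covered : ℕ → Set _
      Covered k = ∀ (s : Fin (suc k)) → ∃[ i ]
        holds (base (congᴿ (suc k) zero)) (suc (m i) · (toℕ s · 1#) + v (β i) ∷ [])

      Pattern : Pred Carrier _
      Pattern y = (∀ l → ¬ y ≈ v (ε l)) ×
                  (∀ i → holds P (suc (m i) · y + v (β i) ∷ [])) ×
                  (∀ j → ¬ holds P (suc (m′ j) · y + v (β′ j) ∷ []))

      ⊨-clash : ∀ i j → S ⊨ clash m m′ β β′ ε ∂ i j [ v ] ⇔ Clash i j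
      ⊨-clash i j with m i ℕ.≟ m′ j
      ... | yes mi≡mj = mk⇔ (mi≡mj ,_) proj₂
      ... | no mi≢mj  = mk⇔ (λ ()) (λ (mi≡mj , _) → contradiction mi≡mj mi≢mj)

      ⊨-covered : ∀ k → S ⊨ covered m m′ β β′ ε ∂ +[1+ k ] [ v ] ⇔ Covered k
      ⊨-covered k = mk⇔
        (λ h s → let i , x = to (disjunction s) (to conjunction h s) in i , to (divisible s i) x)
        (λ h → from conjunction (λ s → from (disjunction s) (let i , x = h s in i , from (divisible s i) x)))
        where
        φ : Fin (suc k) → Fin r → Formula 𝓛ₚ n
        φ s i = rel (base (congᴿ (suc k) zero)) (suc (m i) ⊙ (toℕ s ⊙ 𝟙) ⊕ var (β i) ∷ [])
        conjunction = ⊨-⋀ S {v} λ s → ⋁ (φ s)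
        disjunction = λ s → ⊨-⋁ S {v} (φ s)
        divisible   = λ s i → ⊨-cong-symbol zero v (suc (m i) ⊙ (toℕ s ⊙ 𝟙) ⊕ var (β i))
          (trans (eval-⊙⊕ v (suc (m i)) (toℕ s ⊙ 𝟙) (var (β i)))
                 (+-cong (·-cong (suc (m i)) (eval-⊙𝟙 v (toℕ s))) refl))

      ⊨-pattern : ∀ y → S ⊨ pattern-instance m m′ β β′ ε ∂ [ y ∷ v ] ⇔ Pattern y
      ⊨-pattern y = mk⇔
        (λ h → let h₁ , h′ = to (⊨-and S φ₁ (and φ₂ φ₃)) h ; h₂ , h₃ = to (⊨-and S φ₂ φ₃) h′ in
          (λ l → lower ∘ to (⊨-⋀ S _) h₁ l) ,
          (λ i → to (in-P (m i) (β i)) (to (⊨-⋀ S positive) h₂ i)) ,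
          (λ j x∈P → lower (to (⊨-⋀ S negative) h₃ j (from (in-P (m′ j) (β′ j)) x∈P))))
        (λ (h₁ , h₂ , h₃) → from (⊨-and S φ₁ (and φ₂ φ₃))
          (from (⊨-⋀ S avoided) (λ l → lift ∘ h₁ l) , from (⊨-and S φ₂ φ₃)
            ( from (⊨-⋀ S positive) (λ i → from (in-P (m i) (β i)) (h₂ i))
            , from (⊨-⋀ S negative) (λ j → lift ∘ h₃ j ∘ to (in-P (m′ j) (β′ j))))))
        where
        avoided  = λ l → not (equal (var zero) (var (suc (ε l))))
        positive = λ i → rel P (suc (m i) ⊙ var zero ⊕ var (suc (β i)) ∷ [])
        negative = λ j → not (rel P (suc (m′ j) ⊙ var zero ⊕ var (suc (β′ j)) ∷ []))
        φ₁ = ⋀ avoided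
        φ₂ = ⋀ positive
        φ₃ = ⋀ negative
        in-P = λ a (i : Fin n) → ⊨-P (y ∷ v) (suc a ⊙ var zero ⊕ var (suc i))
          (eval-⊙⊕ (y ∷ v) (suc a) (var zero) (var (suc i)))

      ⊨-random-axiom : S ⊨ random-axiom m m′ β β′ ε ∂ [ v ] ⇔
        ((∃[ i ] ∃[ j ] Clash i j) ⊎ (∃[ k ] (+[1+ k ] ∈ ∂ × Covered k)) ⊎ (∃[ y ] Pattern y))
      ⊨-random-axiom = mk⇔
        (λ h → case₁ (to (⊨-or S φ₁ (or φ₂ φ₃)) h))
        λ { (inj₁ (i , j , c)) → from (⊨-or S φ₁ (or φ₂ φ₃))
              (inj₁ (from (⊨-⋁ S _) (i , from (⊨-⋁ S _) (j , from (⊨-clash i j) c))))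
          ; (inj₂ (inj₁ (k , k∈∂ , c))) → from (⊨-or S φ₁ (or φ₂ φ₃)) (inj₂ (from (⊨-or S φ₂ φ₃)
              (inj₁ (from (⊨-⋁ S _) (Any.index k∈∂ ,
                ≡.subst (λ z → S ⊨ covered m m′ β β′ ε ∂ z [ v ]) (Any.lookup-index k∈∂) (from (⊨-covered k) c))))))
          ; (inj₂ (inj₂ (y , p))) → from (⊨-or S φ₁ (or φ₂ φ₃)) (inj₂ (from (⊨-or S φ₂ φ₃)
              (inj₂ (from (⊨-ex S (pattern-instance m m′ β β′ ε ∂)) (y , from (⊨-pattern y) p))))) }
        where
        φ₁ = ⋁ λ i → ⋁ λ j → clash m m′ β β′ ε ∂ i j
        φ₂ = ⋁ λ d → covered m m′ β β′ ε ∂ (lookup ∂ d)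
        φ₃ = ex (pattern-instance m m′ β β′ ε ∂)

        -- When z is not positive, `covered` is `false`, so the remaining cases are empty.
        covered-positive : ∀ z → z ∈ ∂ → S ⊨ covered m m′ β β′ ε ∂ z [ v ] →
                           ∃[ k ] (+[1+ k ] ∈ ∂ × Covered k)
        covered-positive +[1+ k ] z∈∂ h = k , z∈∂ , to (⊨-covered k) h

        case₂ : S ⊨ φ₂ [ v ] ⊎ S ⊨ φ₃ [ v ] →
                (∃[ k ] (+[1+ k ] ∈ ∂ × Covered k)) ⊎ (∃[ y ] Pattern y)
        case₂ (inj₁ h) = let d , x = to (⊨-⋁ S _) h in
          inj₁ (covered-positive (lookup ∂ d) (∈-lookup d) x)
        case₂ (inj₂ h) = let y , p = to (⊨-ex S (pattern-instance m m′ β β′ ε ∂)) h in inj₂ (y , to (⊨-pattern y) p)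

        case₁ : S ⊨ φ₁ [ v ] ⊎ S ⊨ or φ₂ φ₃ [ v ] → _
        case₁ (inj₁ h) = let i , h′ = to (⊨-⋁ S _) h ; j , c = to (⊨-⋁ S _) h′ in
          inj₁ (i , j , to (⊨-clash i j) c)
        case₁ (inj₂ h) = inj₂ (case₂ (to (⊨-or S φ₂ φ₃) h))

-- Transfer of the axioms to a model U of the theory

module Models (em : ∀ {a} → ExcludedMiddle a)
  (M : Structure 𝓛 ℓ) (ι : ElementaryEmbedding 𝒵 M)
  (D : Pred (Structure.Carrier M) ℓ) (D-resp : D Respects (Structure._≈_ M))
  (additively-random : AdditivelyRandom M ι D) (symmetric : SymmetricSubset M D)
  (U : Structure 𝓛ₚ ℓ′) (U⊨Th : IsModelOf U (Th (expand M D D-resp))) where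

  open Classical em
  open Axioms em
  open ElementaryEmbedding ι

  MD : Structure 𝓛ₚ ℓ
  MD = expand M D D-resp

  module Mᵃ = Arithmetic MD
  open Arithmetic U

  valid-in-M : (φ : Formula 𝓛 n) → (∀ v → 𝒵 ⊨ φ [ v ]) → ∀ v → M ⊨ φ [ v ]
  valid-in-M φ h =
    closure-to M φ (⊨-cong M (λ ()) (closure φ) (to (elementary (closure φ) []) (closure-from 𝒵 φ h)))

  transfer : (φ : Formula 𝓛ₚ n) → (∀ v → MD ⊨ φ [ v ]) → ∀ v → U ⊨ φ [ v ]
  transfer φ h = closure-to U φ (U⊨Th (closure φ) (closure-from MD φ h))

  -- The route leads from 𝒵 to M by elementarity, and from M to U as a sentence of the theory of (M,
  -- D); `reduct MD` and `M` are definitionally equal. All arithmetic laws of U are obtained in this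
  -- way from facts about ℤ.
  valid : (φ : Formula 𝓛 n) → (∀ v → 𝒵 ⊨ φ [ v ]) → ∀ v → reduct U ⊨ φ [ v ]
  valid φ h v = to (⊨-formulaₚ U v φ)
    (transfer (formulaₚ φ) (λ w → from (⊨-formulaₚ MD w φ) (valid-in-M φ h w)) v)

  module Uᵃ = Arithmetic (reduct U)
  module Zᵃ = Arithmetic 𝒵

  x₀ : Term 𝓛 (suc n)
  x₀ = var zero

  x₁ : Term 𝓛 (suc (suc n))
  x₁ = var (suc zero)

  x₂ : Term 𝓛 (suc (suc (suc n)))
  x₂ = var (suc (suc zero))

  +-assoc : ∀ x y z → (x + y) + z ≈ x + (y + z)
  +-assoc x y z = trans (+-cong (sym (Uᵃ.eval-⊕ v x₀ x₁)) refl) (trans (sym (Uᵃ.eval-⊕ v (x₀ ⊕ x₁) x₂))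
    (trans (valid (equal ((x₀ ⊕ x₁) ⊕ x₂) (x₀ ⊕ (x₁ ⊕ x₂))) (λ w → ℤ.+-assoc (w zero) _ _) v)
    (trans (Uᵃ.eval-⊕ v x₀ (x₁ ⊕ x₂)) (+-cong refl (Uᵃ.eval-⊕ v x₁ x₂)))))
    where v = x ∷ y ∷ z ∷ []

  +-comm : ∀ x y → x + y ≈ y + x
  +-comm x y = trans (sym (Uᵃ.eval-⊕ v x₀ x₁))
    (trans (valid (equal (x₀ ⊕ x₁) (x₁ ⊕ x₀)) (λ w → ℤ.+-comm (w zero) _) v)
           (Uᵃ.eval-⊕ v x₁ x₀))
    where v = x ∷ y ∷ []

  +-identityˡ : ∀ x → 0# + x ≈ x
  +-identityˡ x = trans (+-cong (sym (Uᵃ.eval-𝟘 v)) refl) (trans (sym (Uᵃ.eval-⊕ v 𝟘 x₀))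
    (valid (equal (𝟘 ⊕ x₀) x₀) (λ _ → ℤ.+-identityˡ _) v))
    where v = x ∷ []

  +-inverseˡ : ∀ x → - x + x ≈ 0#
  +-inverseˡ x = trans (+-cong (sym (Uᵃ.eval-⊖ v x₀)) refl) (trans (sym (Uᵃ.eval-⊕ v (⊖ x₀) x₀))
    (trans (valid (equal (⊖ x₀ ⊕ x₀) 𝟘) (λ w → ℤ.+-inverseˡ (w zero)) v) (Uᵃ.eval-𝟘 v)))
    where v = x ∷ []

  isAbelianGroup : IsAbelianGroup _≈_ _+_ 0# -_
  isAbelianGroup = record
    { isGroup = record
      { isMonoid = record
        { isSemigroup = record
          { isMagma = record { isEquivalence = isEquivalence ; ∙-cong = +-cong }
          ; assoc   = +-assoc
          }
        ; identity = comm∧idˡ⇒id setoid +-comm +-identityˡ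
        }
      ; inverse = comm∧invˡ⇒inv setoid +-comm +-inverseˡ
      ; ⁻¹-cong = neg-cong
      }
    ; comm = +-comm
    }

  torsion-free : ∀ k {x} → suc k · x ≈ 0# → x ≈ 0#
  torsion-free k {x} kx≈0 = trans
    (valid (imp (equal (suc k ⊙ x₀) 𝟘) (equal x₀ 𝟘))
      (λ w eq → Integers.torsion-free k (w zero) (≡.trans (≡.sym (Zᵃ.eval-⊙ w (suc k) x₀)) eq)) v
      (trans (Uᵃ.eval-⊙ v (suc k) x₀) (trans kx≈0 (sym (Uᵃ.eval-𝟘 v)))))
    (Uᵃ.eval-𝟘 v)
    where v = x ∷ []

  division : ∀ k x → ∃[ j ] (j ℕ.< suc k × ∃[ y ] x ≈ suc k · y + j · 1#)
  division k x =
    let y , h = to (⊨-ex (reduct U) {x ∷ []} φ) (valid (ex φ)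
                  (λ w → from (⊨-ex 𝒵 φ) (in-𝒵 w)) (x ∷ []))
        j , eq = to (⊨-⋁ (reduct U) remainder) h
    in toℕ j , toℕ<n j , y , trans eq (Uᵃ.eval-⊙⊕⊙𝟙 (y ∷ x ∷ []) (suc k) x₀ (toℕ j))
    where
    remainder : Vector (Formula 𝓛 2) (suc k)
    remainder j = equal x₁ (suc k ⊙ x₀ ⊕ toℕ j ⊙ 𝟙)
    φ = ⋁ remainder

    in-𝒵 : ∀ w → ∃[ y ] 𝒵 ⊨ φ [ y ∷ w ]
    in-𝒵 w = let y , j , eq = Integers.division k (w zero) in
      y , from (⊨-⋁ 𝒵 remainder) (j , ≡.trans eq (≡.sym (Zᵃ.eval-⊙⊕⊙𝟙 (y ∷ w) (suc k) x₀ (toℕ j))))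

  congruence : ∀ {k} (j : Fin k) x →
               holds (base (congᴿ k j)) (x ∷ []) ⇔ (∃[ y ] x ≈ k · y + toℕ j · 1#)
  congruence {k} j x = mk⇔
    (λ x≡j →
      let y , eq = to (⊨-ex (reduct U) φ) (valid (imp ψ (ex φ)) to-𝒵 v
                     (U.holds-cong (base (congᴿ k j)) (λ { zero → refl }) x≡j))
      in y , trans eq (Uᵃ.eval-⊙⊕⊙𝟙 (y ∷ v) k x₀ (toℕ j)))
    (λ (y , eq) → U.holds-cong (base (congᴿ k j)) (λ { zero → refl })
      (valid (imp (ex φ) ψ) from-𝒵 v
        (from (⊨-ex (reduct U) φ) (y , trans eq (sym (Uᵃ.eval-⊙⊕⊙𝟙 (y ∷ v) k x₀ (toℕ j)))))))
    where
    module U = Structure U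
    v = x ∷ []
    φ : Formula 𝓛 2
    φ = equal x₁ (k ⊙ x₀ ⊕ toℕ j ⊙ 𝟙)
    ψ : Formula 𝓛 1
    ψ = rel (congᴿ k j) (x₀ ∷ [])

    to-𝒵 : ∀ w → 𝒵 ⊨ imp ψ (ex φ) [ w ]
    to-𝒵 w h = let y , eq = Integers.congruence-to k j (w zero) h in
      from (⊨-ex 𝒵 φ) (y , ≡.trans eq (≡.sym (Zᵃ.eval-⊙⊕⊙𝟙 (y ∷ w) k x₀ (toℕ j))))

    from-𝒵 : ∀ w → 𝒵 ⊨ imp (ex φ) ψ [ w ]
    from-𝒵 w h = let y , eq = to (⊨-ex 𝒵 φ) h in
      Integers.congruence-from k j (w zero) y (≡.trans eq (Zᵃ.eval-⊙⊕⊙𝟙 (y ∷ w) k x₀ (toℕ j)))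

  InP-neg : ∀ {x} → holds P (x ∷ []) → holds P (- x ∷ [])
  InP-neg {x} x∈P = to (⊨-P U v (⊖ var zero) (eval-⊖ v (var zero)))
    (transfer (imp (rel P (var zero ∷ [])) (rel P (⊖ var zero ∷ [])))
      (λ w h → from (⊨-P MD w (⊖ var zero) (Mᵃ.eval-⊖ w (var zero))) (to (symmetric (w zero)) h)) v
      (from (⊨-P U v (var zero) refl) x∈P))
    where v = x ∷ []

  mult≡· : ∀ k x → mult M k x ≡ k Mᵃ.· x
  mult≡· zero    x = ≡.refl
  mult≡· (suc k) x = ≡.cong (add M x) (mult≡· k x)

  -- (P2) and (P3) refer to the embedding of ℤ, which no formula mentions. Its values are named by
  -- closed terms, because elementarity preserves the equation of z with its numeral.
  embed≈integer : ∀ z → embed z Mᵃ.≈ Mᵃ.integer z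
  embed≈integer z = Mᵃ.trans (embed≈numeral z) (Mᵃ.reflexive (expand-integer z))
    where
    expand-integer : ∀ z → Arithmetic.integer M z ≡ Mᵃ.integer z
    expand-integer (+ _)    = ≡.refl
    expand-integer -[1+ _ ] = ≡.refl

    embed≈numeral : ∀ z → embed z Mᵃ.≈ Arithmetic.integer M z
    embed≈numeral z = Mᵃ.trans
      (to (elementary (equal (var zero) (numeral z)) (z ∷ []))
          (≡.sym (≡.trans (Zᵃ.eval-numeral (z ∷ []) z) (Integers.integer≡ z))))
      (Arithmetic.eval-numeral M (embed ∘ (z ∷ [])) z)

  module _ {r r′ q : ℕ} (m : Vector ℕ r) (m′ : Vector ℕ r′) where
    private
      open module W = AdditivelyRandomWitness
        (additively-random (suc ∘ m) (suc ∘ m′) (λ _ → ℕ.s≤s ℕ.z≤n) (λ _ → ℕ.s≤s ℕ.z≤n))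
        using (χ; ∂; P1; P2; P3)

      N = r ℕ.+ (r′ ℕ.+ q)

      β : Vector (Fin N) r
      β i = i ↑ˡ (r′ ℕ.+ q)

      β′ : Vector (Fin N) r′
      β′ j = r ↑ʳ (j ↑ˡ q)

      ε : Vector (Fin N) q
      ε l = r ↑ʳ (r′ ↑ʳ l)

    -- Excluded middle decides whether the tuples clash and, if they do not, whether χ holds; (P1)
    -- then yields the pattern and (P2) the covering. Since `∂` depends on the coefficients alone,
    -- one axiom covers all parameters.
    random-in-M : ∀ v → MD ⊨ random-axiom m m′ β β′ ε ∂ [ v ]
    random-in-M v = from (⊨-random-axiom MD m m′ β β′ ε ∂ v) alternatives
      where
      b  = v ∘ β
      b′ = v ∘ β′

      covered-in-M : ∀ k (s : Fin (suc k)) i →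
        DivisibleBySuc M k (linear M (suc (m i)) (embed (+ toℕ s)) (b i)) →
        Mᵃ.holds (base (congᴿ (suc k) zero)) (suc (m i) Mᵃ.· (toℕ s Mᵃ.· Mᵃ.1#) Mᵃ.+ b i ∷ [])
      covered-in-M k s i = Mᵃ.holds-cong (base (congᴿ (suc k) zero)) λ { zero →
        Mᵃ.+-cong (Mᵃ.trans (Mᵃ.reflexive (mult≡· (suc (m i)) (embed (+ toℕ s))))
                            (Mᵃ.·-cong (suc (m i)) (embed≈integer (+ toℕ s)))) Mᵃ.refl }

      Solution : Pred (Structure.Carrier M) ℓ
      Solution a = (∀ i → D (linear M (suc (m i)) a (b i))) × (∀ j → ¬ D (linear M (suc (m′ j)) a (b′ j)))

      linear-D : ∀ k a c → D (linear M k a c) ⇔ D (k Mᵃ.· a Mᵃ.+ c)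
      linear-D k a c = mk⇔ (≡.subst (λ x → D (add M x c)) (mult≡· k a))
                           (≡.subst (λ x → D (add M x c)) (≡.sym (mult≡· k a)))

      -- If every solution were among the elements to avoid, these would form a finite list of all
      -- solutions.
      solution : IsInfinite M Solution → ∃[ y ] Pattern MD m m′ β β′ ε ∂ v y
      solution infinite = by-contradiction λ none → infinite
        (List.tabulate (v ∘ ε) , λ a (pos , neg) → by-contradiction λ a∉ → none
          (a , (λ l a≈e → a∉ (Any.tabulate⁺ l a≈e))
             , (λ i → to (linear-D (suc (m i)) a (b i)) (pos i))
             , (λ j → neg j ∘ from (linear-D (suc (m′ j)) a (b′ j)))))

      Alternatives : Set ℓ
      Alternatives = (∃[ i ] ∃[ j ] Clash MD m m′ β β′ ε ∂ v i j) ⊎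
                     (∃[ k ] (+[1+ k ] ∈ ∂ × Covered MD m m′ β β′ ε ∂ v k)) ⊎
                     (∃[ y ] Pattern MD m m′ β β′ ε ∂ v y)

      distinct-alternatives : W.Distinct b b′ → Alternatives
      distinct-alternatives distinct with em {P = M ⊨ χ [ b ++ b′ ]}
      ... | yes h = inj₂ (inj₂ (solution (P1 b b′ distinct h)))
      ... | no ¬h =
        let _ , k , k∈∂ , covers = P2 b b′ distinct ¬h
        in inj₂ (inj₁ (k , k∈∂ , λ s → let i , d = covers (toℕ s) (toℕ<n s) in i , covered-in-M k s i d))

      alternatives : Alternatives
      alternatives with em {P = ∃[ i ] ∃[ j ] Clash MD m m′ β β′ ε ∂ v i j}
      ... | yes clash = inj₁ clash
      ... | no ¬clash = distinct-alternatives
        λ i j (eq , eq′) → ¬clash (i , j , ≡.cong ℕ.pred eq , eq′)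

    divisible : ∀ k {x} → holds (base (congᴿ (suc k) zero)) (x ∷ []) ⇔ (∃[ y ] x ≈ suc k · y)
    divisible k {x} = mk⇔
      (λ h → let y , eq = to (congruence zero x) h in y , trans eq (+-identityʳ _))
      (λ (y , eq) → from (congruence zero x) (y , trans eq (sym (+-identityʳ _))))
      where
      +-identityʳ : ∀ y → y + 0# ≈ y
      +-identityʳ y = trans (+-comm y 0#) (+-identityˡ y)

    -- The list from (P3) can be written with numerals, so a single axiom confines these elements of
    -- P to the same integers in U.
    finite : ∀ k → +[1+ k ] ∈ ∂ → ∀ x → holds P (x ∷ []) → (∃[ y ] x ≈ suc k · y) → ∃[ z ] x ≈ integer z
    finite k k∈∂ x x∈P k∣x =
      let i , eq = to (⊨-finite-axiom U k zs (x ∷ [])) (transfer (finite-axiom k zs) in-M (x ∷ []))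
                     x∈P (from (divisible k) k∣x)
      in lookup zs i , eq
      where
      zs  = proj₁ (P3 k k∈∂)
      in-M : ∀ v → MD ⊨ finite-axiom k zs [ v ]
      in-M v = from (⊨-finite-axiom MD k zs v) λ x∈D k∣x →
        let any = proj₂ (P3 k k∈∂) (v zero) x∈D
                    (Mᵃ.holds-cong (base (congᴿ (suc k) zero)) (λ { zero → Mᵃ.refl }) k∣x)
        in Any.index any , Mᵃ.trans (Any.lookup-index any) (embed≈integer _)

    module _ (b : Vector Carrier r) (b′ : Vector Carrier r′) (e : Vector Carrier q) where
      private
        v : Vector Carrier N
        v = b ++ (b′ ++ e)

        vβ : ∀ i → v (β i) ≈ b i
        vβ i = reflexive (lookup-++ˡ b (b′ ++ e) i)

        vβ′ : ∀ j → v (β′ j) ≈ b′ j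
        vβ′ j = reflexive (≡.trans (lookup-++ʳ b (b′ ++ e) (j ↑ˡ q)) (lookup-++ˡ b′ e j))

        vε : ∀ l → v (ε l) ≈ e l
        vε l = reflexive (≡.trans (lookup-++ʳ b (b′ ++ e) (r′ ↑ʳ l)) (lookup-++ʳ b′ e l))

      random :
        (∀ i j → ¬ (m i ≡ m′ j × b i ≈ b′ j)) →
        (∃[ y ] ((∀ l → ¬ y ≈ e l) × (∀ i → holds P (suc (m i) · y + b i ∷ [])) ×
                 (∀ j → ¬ holds P (suc (m′ j) · y + b′ j ∷ [])))) ⊎
        (∃[ k ] ((∀ x → holds P (x ∷ []) → (∃[ y ] x ≈ suc k · y) → ∃[ z ] x ≈ integer z) ×
                 (∀ s → s ℕ.< suc k → ∃[ i ] ∃[ y ] suc (m i) · (s · 1#) + b i ≈ suc k · y)))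
      random distinct
        with to (⊨-random-axiom U m m′ β β′ ε ∂ v) (transfer (random-axiom m m′ β β′ ε ∂) random-in-M v)
      ... | inj₁ (i , j , eq , eq′) =
        contradiction (eq , trans (sym (vβ i)) (trans eq′ (vβ′ j))) (distinct i j)
      ... | inj₂ (inj₁ (k , k∈∂ , covers)) = inj₂ (k , finite k k∈∂ , λ s s<k →
        let i , h  = covers (fromℕ< s<k)
            y , eq = to (divisible k) h
            s≈     = reflexive (≡.cong (_· 1#) (≡.sym (toℕ-fromℕ< s<k)))
        in i , y , trans (+-cong (·-cong (suc (m i)) s≈) (sym (vβ i))) eq)
      ... | inj₂ (inj₂ (y , avoids , pos , neg)) = inj₁ (y ,
        (λ l y≈e → avoids l (trans y≈e (sym (vε l)))) ,
        (λ i → holds-cong P (λ { zero → +-cong refl (vβ i) }) (pos i)) ,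
        (λ j → neg j ∘ holds-cong P (λ { zero → +-cong refl (sym (vβ′ j)) })))

  isRandomGroup : IsRandomGroup U
  isRandomGroup = record
    { isAbelianGroup = isAbelianGroup
    ; torsion-free   = torsion-free
    ; division       = division
    ; congruence     = congruence
    ; InP-neg        = InP-neg
    ; random         = λ m m′ → random m m′
    }

-- Back and forth

-- multiple l says l + 1 ∣ x, and multipleOfP l says x ∈ (l + 1) P.
data Kind : Set where
  vanishing   : Kind
  multiple    : (l : ℕ) → Kind
  multipleOfP : (l : ℕ) → Kind

modulus-1 : Kind → ℕ
modulus-1 vanishing       = 0
modulus-1 (multiple l)    = l
modulus-1 (multipleOfP l) = l

-- The modulus l + 1 becomes (a + 1)(l + 1), and l + a (l + 1) is one less than this product.
scale : ℕ → Kind → Kind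
scale a vanishing       = vanishing
scale a (multiple l)    = multiple (l ℕ.+ a ℕ.* suc l)
scale a (multipleOfP l) = multipleOfP (l ℕ.+ a ℕ.* suc l)

-- With the sign as data, a condition and its negation share most of the reduction below.
Signed : Bool → Set ℓ → Set ℓ
Signed true  A = A
Signed false A = ¬ A

Signed-⇔ : ∀ σ {A B : Set ℓ} → A ⇔ B → Signed σ A → Signed σ B
Signed-⇔ true  A⇔B a  = to A⇔B a
Signed-⇔ false A⇔B ¬a = ¬a ∘ from A⇔B

lookup⁻ : {A : Set ℓ} {Q : Pred A ℓ} (xs : List A) → (∀ i → Q (lookup xs i)) → All Q xs
lookup⁻ []ᴸ       h = []ᴸ
lookup⁻ (x ∷ᴸ xs) h = h zero ∷ᴸ lookup⁻ xs (h ∘ suc)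

common-multiple : {A : Set} (f : A → ℕ) (xs : List A) → ∃[ m ] All (λ x → suc (f x) ∣ suc m) xs
common-multiple f []ᴸ       = 0 , []ᴸ
common-multiple f (x ∷ᴸ xs) =
  let m , h = common-multiple f xs
  -- One more than this number is (f x + 1)(m + 1); a product serves as well as the least common
  -- multiple.
  in m ℕ.+ f x ℕ.* suc m , m∣m*n (suc m) ∷ᴸ All.map (∣n⇒∣m*n (suc (f x))) h

-- Group laws, basic conditions and linear forms of terms

module RandomGroup (em : ∀ {a} → ExcludedMiddle a) (U : Structure 𝓛ₚ ℓ) (isRandomGroup : IsRandomGroup U) where
  open Classical em
  open Axioms em
  open Arithmetic U
  open IsRandomGroup isRandomGroup

  abelianGroup : AbelianGroup ℓ ℓ
  abelianGroup = record { isAbelianGroup = isAbelianGroup }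

  open AbelianGroup abelianGroup
    using (commutativeMonoid; commutativeSemigroup)
    renaming (assoc to +-assoc; comm to +-comm; identityˡ to +-identityˡ; identityʳ to +-identityʳ;
              inverseˡ to +-inverseˡ; inverseʳ to +-inverseʳ)
  open Algebra.Properties.AbelianGroup abelianGroup
    using (inverseˡ-unique; inverseʳ-unique; x∙y⁻¹≈ε⇒x≈y; x≈y⇒x∙y⁻¹≈ε; ⁻¹-∙-comm)
    renaming (⁻¹-involutive to neg-involutive; ∙-cancelʳ to +-cancelʳ)
  open Algebra.Properties.CommutativeMonoid.Mult commutativeMonoid
    using () renaming (×-homo-+ to ·-homo-+; ×-assocˡ to ·-assocˡ; ×-distrib-+ to ·-distrib-+)
  open Algebra.Properties.CommutativeSemigroup commutativeSemigroup using (interchange)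
  open import Relation.Binary.Reasoning.Setoid setoid

  private
    Env : ℕ → Set ℓ
    Env = Vector Carrier

  ⟦_⟧ : Term 𝓛ₚ n → Env n → Carrier
  ⟦ t ⟧ v = eval U v t

  ·-congˡ : ∀ {k l x} → k ≡ l → k · x ≈ l · x
  ·-congˡ ≡.refl = refl

  ·-zeroʳ : ∀ k → k · 0# ≈ 0#
  ·-zeroʳ zero    = refl
  ·-zeroʳ (suc k) = trans (+-identityˡ _) (·-zeroʳ k)

  ·-neg : ∀ k x → k · (- x) ≈ - (k · x)
  ·-neg k x = inverseˡ-unique _ _ (begin
    k · (- x) + k · x  ≈⟨ ·-distrib-+ (- x) x k ⟨
    k · (- x + x)      ≈⟨ ·-cong k (+-inverseˡ x) ⟩
    k · 0#             ≈⟨ ·-zeroʳ k ⟩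
    0#                 ∎)

  ·-cancelˡ : ∀ k {x y} → suc k · x ≈ suc k · y → x ≈ y
  ·-cancelˡ k {x} {y} eq = x∙y⁻¹≈ε⇒x≈y x y (torsion-free k (begin
    suc k · (x + - y)             ≈⟨ ·-distrib-+ x (- y) (suc k) ⟩
    suc k · x + suc k · (- y)     ≈⟨ +-cong eq (·-neg (suc k) y) ⟩
    suc k · y + - (suc k · y)     ≈⟨ +-inverseʳ _ ⟩
    0#                            ∎))

  ·-comm : ∀ k l x → k · (l · x) ≈ l · (k · x)
  ·-comm k l x = trans (·-assocˡ x k l) (trans (·-congˡ (ℕ.*-comm k l)) (sym (·-assocˡ x l k)))

  -- Torsion-freeness leaves at most one solution. It is named here even if there is none, with `0#`
  -- as a default, so that each equation excludes one definite element.
  root : ∀ k z → ∃[ g ] (∀ y → suc k · y ≈ z → y ≈ g)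
  root k z with em {P = ∃[ g ] suc k · g ≈ z}
  ... | yes (g , eq) = g , λ y eq′ → ·-cancelˡ k (trans eq′ (sym eq))
  ... | no none      = 0# , λ y eq → contradiction (y , eq) none

  InP-cong : ∀ {x y} → x ≈ y → InP x → InP y
  InP-cong x≈y = holds-cong P (λ { zero → x≈y })

  Holds : Kind → Pred Carrier ℓ
  Holds vanishing       x = x ≈ 0#
  Holds (multiple l)    x = Divisible l x
  Holds (multipleOfP l) x = ∃[ y ] (x ≈ suc l · y × InP y)

  Holds-resp : ∀ κ {x y} → x ≈ y → Holds κ x → Holds κ y
  Holds-resp vanishing       x≈y h            = trans (sym x≈y) h
  Holds-resp (multiple l)    x≈y (z , eq)     = z , trans (sym x≈y) eq
  Holds-resp (multipleOfP l) x≈y (z , eq , p) = z , trans (sym x≈y) eq , p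

  Holds-cong : ∀ κ {x y} → x ≈ y → Holds κ x ⇔ Holds κ y
  Holds-cong κ x≈y = mk⇔ (Holds-resp κ x≈y) (Holds-resp κ (sym x≈y))

  Holds-neg⁺ : ∀ κ {x} → Holds κ x → Holds κ (- x)
  Holds-neg⁺ vanishing h = trans (neg-cong h) (sym (inverseʳ-unique 0# 0# (+-identityˡ 0#)))
  Holds-neg⁺ (multiple l) (z , eq) = - z , trans (neg-cong eq) (sym (·-neg (suc l) z))
  Holds-neg⁺ (multipleOfP l) (z , eq , p) =
    - z , trans (neg-cong eq) (sym (·-neg (suc l) z)) , InP-neg p

  Holds-neg : ∀ κ {x} → Holds κ (- x) ⇔ Holds κ x
  Holds-neg κ {x} = mk⇔ (Holds-resp κ (neg-involutive x) ∘ Holds-neg⁺ κ) (Holds-neg⁺ κ)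

  -- For multiples and multiples of P the same witness z serves on both sides, and the factor a + 1
  -- is cancelled by torsion-freeness.
  Holds-scale : ∀ a κ {x} → Holds κ x ⇔ Holds (scale a κ) (suc a · x)
  Holds-scale a vanishing = mk⇔
    (λ eq → trans (·-cong (suc a) eq) (·-zeroʳ (suc a)))
    (torsion-free a)
  Holds-scale a (multiple l) = mk⇔
    (λ (z , eq) → z , trans (·-cong (suc a) eq) (·-assocˡ z (suc a) (suc l)))
    (λ (z , eq) → z , ·-cancelˡ a (trans eq (sym (·-assocˡ z (suc a) (suc l)))))
  Holds-scale a (multipleOfP l) = mk⇔
    (λ (z , eq , p) → z , trans (·-cong (suc a) eq) (·-assocˡ z (suc a) (suc l)) , p)
    (λ (z , eq , p) → z , ·-cancelˡ a (trans eq (sym (·-assocˡ z (suc a) (suc l)))) , p)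

  basic : Kind → Term 𝓛ₚ n → Formula 𝓛ₚ n
  basic vanishing       t = equal t 𝟘
  basic (multiple l)    t = ex (equal (rename suc t) (suc l ⊙ var zero))
  basic (multipleOfP l) t = ex (and (equal (rename suc t) (suc l ⊙ var zero)) (rel P (var zero ∷ [])))

  ⊨-basic : ∀ κ (t : Term 𝓛ₚ n) v → U ⊨ basic κ t [ v ] ⇔ Holds κ (⟦ t ⟧ v)
  ⊨-basic vanishing t v =
    mk⇔ (λ eq → trans eq (eval-𝟘 v)) (λ eq → trans eq (sym (eval-𝟘 v)))
  ⊨-basic {n} (multiple l) t v = mk⇔
    (λ h → let z , eq = to (⊨-ex U φ) h in z ,
      trans (sym (eval-rename U suc (z ∷ v) t)) (trans eq (eval-⊙ (z ∷ v) (suc l) (var zero))))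
    (λ (z , eq) → from (⊨-ex U φ) (z ,
      trans (eval-rename U suc (z ∷ v) t) (trans eq (sym (eval-⊙ (z ∷ v) (suc l) (var zero))))))
    where
    φ : Formula 𝓛ₚ (suc n)
    φ = equal (rename suc t) (suc l ⊙ var zero)
  ⊨-basic {n} (multipleOfP l) t v = mk⇔
    (λ h → let z , h′ = to (⊨-ex U (and φ ψ)) h ; eq , p = to (⊨-and U φ ψ) h′ in z ,
      trans (sym (eval-rename U suc (z ∷ v) t)) (trans eq (eval-⊙ (z ∷ v) (suc l) (var zero))) ,
      to (⊨-P U (z ∷ v) (var zero) refl) p)
    (λ (z , eq , p) → from (⊨-ex U (and φ ψ)) (z , from (⊨-and U φ ψ)
      ( trans (eval-rename U suc (z ∷ v) t) (trans eq (sym (eval-⊙ (z ∷ v) (suc l) (var zero))))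
      , from (⊨-P U (z ∷ v) (var zero) refl) p)))
    where
    φ ψ : Formula 𝓛ₚ (suc n)
    φ = equal (rename suc t) (suc l ⊙ var zero)
    ψ = rel P (var zero ∷ [])

  -- Separate natural coefficients for x and - x make the induction on terms free of case
  -- distinctions; `normal-form` subtracts them after comparing their sizes.
  Linear : Term 𝓛ₚ (suc n) → Set ℓ
  Linear {n} t = ∃[ k ] ∃[ k′ ] Σ[ s ∈ Term 𝓛ₚ n ]
    (∀ x v → ⟦ t ⟧ (x ∷ v) ≈ k · x + k′ · (- x) + ⟦ s ⟧ v)

  linear-form : (t : Term 𝓛ₚ (suc n)) → Linear t
  linear-form (var zero) = 1 , 0 , 𝟘 , λ x v → sym (begin
    x + 0# + 0# + ⟦ 𝟘 ⟧ v  ≈⟨ +-cong refl (eval-𝟘 v) ⟩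
    x + 0# + 0# + 0#       ≈⟨ +-identityʳ _ ⟩
    x + 0# + 0#            ≈⟨ +-identityʳ _ ⟩
    x + 0#                 ≈⟨ +-identityʳ _ ⟩
    x                      ∎)
  linear-form (var (suc i)) = 0 , 0 , var i , λ x v →
    sym (trans (+-cong (+-identityˡ 0#) refl) (+-identityˡ (v i)))
  linear-form (app zeroᶠ ts) = 0 , 0 , 𝟘 , λ x v → trans (fun-cong zeroᶠ (λ ()))
    (sym (trans (+-cong (+-identityˡ 0#) refl) (+-identityˡ _)))
  linear-form (app oneᶠ ts) = 0 , 0 , 𝟙 , λ x v → trans (fun-cong oneᶠ (λ ()))
    (sym (trans (+-cong (+-identityˡ 0#) refl) (+-identityˡ _)))
  linear-form (app negᶠ ts) with linear-form (ts zero)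
  ... | k , k′ , s , eq = k′ , k , ⊖ s , λ x v → begin
    ⟦ app negᶠ ts ⟧ (x ∷ v)                    ≈⟨ fun-cong negᶠ (λ { zero → refl }) ⟩
    - ⟦ ts zero ⟧ (x ∷ v)                      ≈⟨ neg-cong (eq x v) ⟩
    - (k · x + k′ · (- x) + ⟦ s ⟧ v)           ≈⟨ ⁻¹-∙-comm _ _ ⟨
    - (k · x + k′ · (- x)) + - ⟦ s ⟧ v         ≈⟨ +-cong (⁻¹-∙-comm _ _) (eval-⊖ v s) ⟨
    - (k · x) + - (k′ · (- x)) + ⟦ ⊖ s ⟧ v     ≈⟨ +-cong (+-cong (·-neg k x) (·-neg k′ (- x))) refl ⟨
    k · (- x) + k′ · (- - x) + ⟦ ⊖ s ⟧ v       ≈⟨ +-cong (+-comm _ _) refl ⟩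
    k′ · (- - x) + k · (- x) + ⟦ ⊖ s ⟧ v       ≈⟨ +-cong (+-cong (·-cong k′ (neg-involutive x)) refl) refl ⟩
    k′ · x + k · (- x) + ⟦ ⊖ s ⟧ v             ∎
  linear-form (app addᶠ ts) with linear-form (ts zero) | linear-form (ts (suc zero))
  ... | k , k′ , s , eq | l , l′ , t , eq′ = k ℕ.+ l , k′ ℕ.+ l′ , s ⊕ t , λ x v → begin
    ⟦ app addᶠ ts ⟧ (x ∷ v)
      ≈⟨ fun-cong addᶠ (λ { zero → refl ; (suc zero) → refl }) ⟩
    ⟦ ts zero ⟧ (x ∷ v) + ⟦ ts (suc zero) ⟧ (x ∷ v)
      ≈⟨ +-cong (eq x v) (eq′ x v) ⟩
    (k · x + k′ · (- x) + ⟦ s ⟧ v) + (l · x + l′ · (- x) + ⟦ t ⟧ v)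
      ≈⟨ interchange _ _ _ _ ⟩
    (k · x + k′ · (- x) + (l · x + l′ · (- x))) + (⟦ s ⟧ v + ⟦ t ⟧ v)
      ≈⟨ +-cong (interchange _ _ _ _) (sym (eval-⊕ v s t)) ⟩
    (k · x + l · x) + (k′ · (- x) + l′ · (- x)) + ⟦ s ⊕ t ⟧ v
      ≈⟨ +-cong (+-cong (·-homo-+ x k l) (·-homo-+ (- x) k′ l′)) refl ⟨
    (k ℕ.+ l) · x + (k′ ℕ.+ l′) · (- x) + ⟦ s ⊕ t ⟧ v
      ∎

  difference : ∀ k d x → (d ℕ.+ k) · x + k · (- x) ≈ d · x
  difference k d x = begin
    (d ℕ.+ k) · x + k · (- x)      ≈⟨ +-cong (·-homo-+ x d k) (·-neg k x) ⟩
    d · x + k · x + - (k · x)      ≈⟨ +-assoc _ _ _ ⟩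
    d · x + (k · x + - (k · x))    ≈⟨ +-cong refl (+-inverseʳ _) ⟩
    d · x + 0#                     ≈⟨ +-identityʳ _ ⟩
    d · x                          ∎

  -- Since P is symmetric, a term may be replaced by its negative; so the
  -- coefficient of the new variable can be taken in ℕ.
  normal-form : ∀ κ (t : Term 𝓛ₚ (suc n)) → ∃[ k ] Σ[ s ∈ Term 𝓛ₚ n ]
    (∀ x v → Holds κ (⟦ t ⟧ (x ∷ v)) ⇔ Holds κ (k · x + ⟦ s ⟧ v))
  normal-form κ t with linear-form t
  ... | k , k′ , s , eq with ℕ.≤-total k′ k
  ... | inj₁ k′≤k = k ℕ.∸ k′ , s , λ x v → Holds-cong κ (trans (eq x v) (+-cong (begin
    k · x + k′ · (- x)                    ≈⟨ +-cong (·-congˡ (ℕ.m∸n+n≡m k′≤k)) refl ⟨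
    (k ℕ.∸ k′ ℕ.+ k′) · x + k′ · (- x)    ≈⟨ difference k′ (k ℕ.∸ k′) x ⟩
    (k ℕ.∸ k′) · x                        ∎) refl))
  ... | inj₂ k≤k′ = k′ ℕ.∸ k , ⊖ s , λ x v → Holds-neg κ ⇔-∘ Holds-cong κ (begin
    ⟦ t ⟧ (x ∷ v)                                        ≈⟨ eq x v ⟩
    k · x + k′ · (- x) + ⟦ s ⟧ v                         ≈⟨ +-cong (+-comm _ _) refl ⟩
    k′ · (- x) + k · x + ⟦ s ⟧ v
      ≈⟨ +-cong (+-cong (·-congˡ (ℕ.m∸n+n≡m k≤k′)) (·-cong k (neg-involutive x))) (neg-involutive _) ⟨
    (k′ ℕ.∸ k ℕ.+ k) · (- x) + k · (- - x) + - - ⟦ s ⟧ v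
      ≈⟨ +-cong (difference k (k′ ℕ.∸ k) (- x)) (neg-cong (sym (eval-⊖ v s))) ⟩
    (k′ ℕ.∸ k) · (- x) + - ⟦ ⊖ s ⟧ v                     ≈⟨ +-cong (·-neg (k′ ℕ.∸ k) x) refl ⟩
    - ((k′ ℕ.∸ k) · x) + - ⟦ ⊖ s ⟧ v                     ≈⟨ ⁻¹-∙-comm _ _ ⟩
    - ((k′ ℕ.∸ k) · x + ⟦ ⊖ s ⟧ v)                       ∎)

  infix 4 _∼_

  _∼_ : Env n → Env n → Set ℓ
  u ∼ v = ∀ κ t → Holds κ (⟦ t ⟧ u) ⇔ Holds κ (⟦ t ⟧ v)

  ∼-sym : {u v : Env n} → u ∼ v → v ∼ u
  ∼-sym u∼v κ t = ⇔-sym (u∼v κ t)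

  ∼-equal : {u v : Env n} → u ∼ v → ∀ s t → ⟦ s ⟧ u ≈ ⟦ t ⟧ u → ⟦ s ⟧ v ≈ ⟦ t ⟧ v
  ∼-equal {u = u} {v} u∼v s t eq = x∙y⁻¹≈ε⇒x≈y _ _ (trans (sym (eval-⊕⊖ v)) (to (u∼v vanishing (s ⊕ ⊖ t))
    (trans (eval-⊕⊖ u) (x≈y⇒x∙y⁻¹≈ε eq))))
    where
    eval-⊕⊖ : ∀ w → ⟦ s ⊕ ⊖ t ⟧ w ≈ ⟦ s ⟧ w + - ⟦ t ⟧ w
    eval-⊕⊖ w = trans (eval-⊕ w s (⊖ t)) (+-cong refl (eval-⊖ w t))

  multiple-+ : ∀ l {k} x z → suc l ∣ k → Holds (multiple l) (k · x + z) ⇔ Holds (multiple l) z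
  multiple-+ l x z (divides q ≡.refl) = mk⇔
    (λ (w , eq) → w + - (q · x) , (begin
      z                                   ≈⟨ +-identityˡ z ⟨
      0# + z                              ≈⟨ +-cong (+-inverseˡ qlx) refl ⟨
      - qlx + qlx + z                     ≈⟨ +-assoc _ _ _ ⟩
      - qlx + (qlx + z)                   ≈⟨ +-comm _ _ ⟩
      qlx + z + - qlx                     ≈⟨ +-cong eq (neg-cong assoc) ⟩
      suc l · w + - (suc l · (q · x))     ≈⟨ +-cong refl (·-neg (suc l) (q · x)) ⟨
      suc l · w + suc l · (- (q · x))     ≈⟨ ·-distrib-+ w (- (q · x)) (suc l) ⟨
      suc l · (w + - (q · x))             ∎))
    (λ (w , eq) → q · x + w , (begin
      qlx + z                             ≈⟨ +-cong assoc eq ⟩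
      suc l · (q · x) + suc l · w         ≈⟨ ·-distrib-+ (q · x) w (suc l) ⟨
      suc l · (q · x + w)                 ∎))
    where
    qlx = (q ℕ.* suc l) · x
    assoc : qlx ≈ suc l · (q · x)
    assoc = trans (·-congˡ (ℕ.*-comm q (suc l))) (sym (·-assocˡ x (suc l) q))

  -- Once l + 1 divides the coefficient and the constant term, it cancels and leaves a condition on
  -- P itself, the form to which additive randomness applies.
  multipleOfP-+ : ∀ l q x {z b} → z ≈ suc l · b →
                  Holds (multipleOfP l) ((q ℕ.* suc l) · x + z) ⇔ InP (q · x + b)
  multipleOfP-+ l q x {z} {b} z≈lb = mk⇔
    (λ (w , eq , p) → InP-cong (·-cancelˡ l (trans (sym eq) split)) p)
    (λ p → q · x + b , split , p)
    where
    split : (q ℕ.* suc l) · x + z ≈ suc l · (q · x + b)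
    split = begin
      (q ℕ.* suc l) · x + z        ≈⟨ +-cong (·-congˡ (ℕ.*-comm q (suc l))) z≈lb ⟩
      (suc l ℕ.* q) · x + suc l · b ≈⟨ +-cong (·-assocˡ x (suc l) q) refl ⟨
      suc l · (q · x) + suc l · b  ≈⟨ ·-distrib-+ (q · x) b (suc l) ⟨
      suc l · (q · x + b)          ∎

  -- Extension by a transcendental element along a sequence

  Transcendental : Carrier → Pred (Env n) ℓ
  Transcendental c u = ∀ k t → ¬ suc k · c ≈ ⟦ t ⟧ u

  module Extension
    (u : Env n) (v : ℕ → Env n) (u∼v : ∀ i → u ∼ v i)
    (coherent : ∀ i j s t → ⟦ s ⟧ (v i) ≈ ⟦ t ⟧ (v j) → ⟦ s ⟧ u ≈ ⟦ t ⟧ u) where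

    -- What a condition can still demand of y: nothing, when it is settled by the tuple; to differ
    -- from one element, when it is a negated equation; or a signed membership in P with positive
    -- coefficient m + 1.
    data Requirement : Set ℓ where
      none    : Requirement
      avoid   : Carrier → Requirement
      literal : Bool → ℕ → Carrier → Requirement

    Satisfies : Carrier → Pred Requirement ℓ
    Satisfies y none            = ⊤
    Satisfies y (avoid g)       = ¬ y ≈ g
    Satisfies y (literal σ m b) = Signed σ (InP (suc m · y + b))

    module _ (y : Carrier) (y-transcendental : Transcendental y u) where

      -- b′ is the image of some b in the divisible hull of u under u ↦ v i.
      Reflected : Bool → Pred (ℕ × Carrier) ℓ
      Reflected σ (m , b′) = ∃[ i ] ∃[ l ] ∃[ t ] ∃[ b ]
        (⟦ t ⟧ u ≈ suc l · b × ⟦ t ⟧ (v i) ≈ suc l · b′ × Signed σ (InP (suc m · y + b)))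

      Admissible : Pred Requirement ℓ
      Admissible (literal σ m b′) = Reflected σ (m , b′)
      Admissible _                = ⊤

      -- As the modulus divides k, divisibility of the whole term depends on s alone, and `u∼v`
      -- transfers it. An equation that holds with positive coefficient would contradict the
      -- transcendence of y.
      reduce : ∀ i σ κ k s → suc (modulus-1 κ) ∣ k → Signed σ (Holds κ (k · y + ⟦ s ⟧ u)) →
        ∃[ ρ ] (Admissible ρ × (∀ y′ → Satisfies y′ ρ → Signed σ (Holds κ (k · y′ + ⟦ s ⟧ (v i)))))
      reduce i σ κ zero s _ h = none , tt , λ y′ _ →
        Signed-⇔ σ (Holds-cong κ (sym (+-identityˡ _)) ⇔-∘ (u∼v i κ s ⇔-∘ Holds-cong κ (+-identityˡ _))) h
      reduce i true vanishing (suc k) s _ h = contradiction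
        (trans (inverseˡ-unique _ _ h) (sym (eval-⊖ u s))) (y-transcendental k (⊖ s))
      reduce i false vanishing (suc k) s _ h =
        let g , unique = root k (- ⟦ s ⟧ (v i)) in
        avoid g , tt , λ y′ y′≉g eq → y′≉g (unique y′ (inverseˡ-unique _ _ eq))
      reduce i σ (multiple l) (suc k) s l∣k h = none , tt , λ y′ _ →
        Signed-⇔ σ (⇔-sym (multiple-+ l y′ (⟦ s ⟧ (v i)) l∣k))
        (Signed-⇔ σ (u∼v i (multiple l) s)
        (Signed-⇔ σ (multiple-+ l y (⟦ s ⟧ u) l∣k) h))
      -- A positive coefficient has a positive quotient, whence `suc q`.
      reduce i σ (multipleOfP l) (suc k) s l∣k@(divides (suc q) ≡.refl) h with em {P = Divisible l (⟦ s ⟧ u)}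
      ... | yes (b , eq) =
        let b′ , eq′ = to (u∼v i (multiple l) s) (b , eq) in
        literal σ q b′ ,
        (i , l , s , b , eq , eq′ , Signed-⇔ σ (multipleOfP-+ l (suc q) y eq) h) ,
        λ y′ → Signed-⇔ σ (⇔-sym (multipleOfP-+ l (suc q) y′ eq′))
      -- With s indivisible the term is never a multiple of l + 1, so the condition fails for every
      -- choice of y and of y′.
      ... | no l∤s = none , tt , λ y′ _ → indivisible σ y′ h
        where
        indivisible : ∀ σ y′ → Signed σ (Holds (multipleOfP l) (suc k · y + ⟦ s ⟧ u)) →
                      Signed σ (Holds (multipleOfP l) (suc k · y′ + ⟦ s ⟧ (v i)))
        indivisible true y′ (w , eq , _) =
          contradiction (to (multiple-+ l y (⟦ s ⟧ u) l∣k) (w , eq)) l∤s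
        indivisible false y′ _ (w , eq , _) = l∤s (from (u∼v i (multiple l) s)
          (to (multiple-+ l y′ (⟦ s ⟧ (v i)) l∣k) (w , eq)))

      -- Otherwise b and b₁ would agree by coherence, but y tells them apart.
      distinct : ∀ {m m₁ b′ b₁′} → Reflected true (m , b′) → Reflected false (m₁ , b₁′) →
                 ¬ (m ≡ m₁ × b′ ≈ b₁′)
      distinct {b′ = b′} {b₁′} (i , l , t , b , eq , eq′ , p)
               (i₁ , l₁ , t₁ , b₁ , eq₁ , eq₁′ , ¬p) (≡.refl , b′≈b₁′) =
        ¬p (InP-cong (+-cong refl b≈b₁) p)
        where
        images : ⟦ suc l₁ ⊙ t ⟧ (v i) ≈ ⟦ suc l ⊙ t₁ ⟧ (v i₁)
        images = begin
          ⟦ suc l₁ ⊙ t ⟧ (v i)       ≈⟨ eval-⊙ (v i) (suc l₁) t ⟩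
          suc l₁ · ⟦ t ⟧ (v i)       ≈⟨ ·-cong (suc l₁) eq′ ⟩
          suc l₁ · (suc l · b′)      ≈⟨ ·-comm (suc l₁) (suc l) b′ ⟩
          suc l · (suc l₁ · b′)      ≈⟨ ·-cong (suc l) (·-cong (suc l₁) b′≈b₁′) ⟩
          suc l · (suc l₁ · b₁′)     ≈⟨ ·-cong (suc l) eq₁′ ⟨
          suc l · ⟦ t₁ ⟧ (v i₁)      ≈⟨ eval-⊙ (v i₁) (suc l) t₁ ⟨
          ⟦ suc l ⊙ t₁ ⟧ (v i₁)      ∎
        b≈b₁ : b ≈ b₁
        b≈b₁ = ·-cancelˡ l₁ (·-cancelˡ l (begin
          suc l · (suc l₁ · b)       ≈⟨ ·-comm (suc l) (suc l₁) b ⟩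
          suc l₁ · (suc l · b)       ≈⟨ ·-cong (suc l₁) eq ⟨
          suc l₁ · ⟦ t ⟧ u           ≈⟨ eval-⊙ u (suc l₁) t ⟨
          ⟦ suc l₁ ⊙ t ⟧ u           ≈⟨ coherent i i₁ (suc l₁ ⊙ t) (suc l ⊙ t₁) images ⟩
          ⟦ suc l ⊙ t₁ ⟧ u           ≈⟨ eval-⊙ u (suc l) t₁ ⟩
          suc l · ⟦ t₁ ⟧ u           ≈⟨ ·-cong (suc l) eq₁ ⟩
          suc l · (suc l₁ · b₁)      ∎))

      -- The element b lies only in the divisible hull of u and 1. Multiplying by l + 1 turns the
      -- sum into the value of a term, to which `u∼v` applies.
      reflected-divisible : ∀ k s i l t {b b′} m → ⟦ t ⟧ u ≈ suc l · b → ⟦ t ⟧ (v i) ≈ suc l · b′ →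
        Divisible k (m · (s · 1#) + b′) → Divisible k (m · (s · 1#) + b)
      reflected-divisible k s i l t m eq eq′ =
        from (Holds-scale l (multiple k)) ∘ Holds-resp (scale l (multiple k)) (value u eq) ∘
        from (u∼v i (scale l (multiple k)) τ) ∘ Holds-resp (scale l (multiple k)) (sym (value (v i) eq′)) ∘
        to (Holds-scale l (multiple k))
        where
        τ : Term 𝓛ₚ n
        τ = suc l ⊙ (m ⊙ (s ⊙ 𝟙)) ⊕ t
        value : ∀ w {x} → ⟦ t ⟧ w ≈ suc l · x → ⟦ τ ⟧ w ≈ suc l · (m · (s · 1#) + x)
        value w {x} eq = begin
          ⟦ τ ⟧ w                                       ≈⟨ eval-⊙⊕ w (suc l) (m ⊙ (s ⊙ 𝟙)) t ⟩
          suc l · ⟦ m ⊙ (s ⊙ 𝟙) ⟧ w + ⟦ t ⟧ w           ≈⟨ +-cong (·-cong (suc l) (eval-⊙ w m (s ⊙ 𝟙))) eq ⟩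
          suc l · (m · ⟦ s ⊙ 𝟙 ⟧ w) + suc l · x         ≈⟨ +-cong (·-cong (suc l) (·-cong m (eval-⊙𝟙 w s))) refl ⟩
          suc l · (m · (s · 1#)) + suc l · x            ≈⟨ ·-distrib-+ (m · (s · 1#)) x (suc l) ⟨
          suc l · (m · (s · 1#) + x)                    ∎

      -- Covering would put m y + b into P ∩ (k + 1)U, hence into ℤ, making y algebraic.
      not-covered : ∀ k (finite : ∀ x → InP x → Divisible k x → ∃[ z ] x ≈ integer z) s (w : Carrier) →
        y ≈ suc k · w + s · 1# → ∀ m {b′} → Reflected true (m , b′) →
        ¬ Divisible k (suc m · (s · 1#) + b′)
      not-covered k finite s w y≈ m (i , l , t , b , eq , eq′ , p) k∣ =
        -- One more than this number is (l + 1)(m + 1), the coefficient of y after (m + 1) y + b = z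
        -- is multiplied by the denominator l + 1 of b.
        y-transcendental (m ℕ.+ l ℕ.* suc m) (suc l ⊙ numeral (proj₁ value) ⊕ ⊖ t) (begin
          (suc l ℕ.* suc m) · y                             ≈⟨ ·-assocˡ y (suc l) (suc m) ⟨
          suc l · (suc m · y)                               ≈⟨ +-identityʳ _ ⟨
          suc l · (suc m · y) + 0#                          ≈⟨ +-cong refl (+-inverseʳ (⟦ t ⟧ u)) ⟨
          suc l · (suc m · y) + (⟦ t ⟧ u + - ⟦ t ⟧ u)       ≈⟨ +-assoc _ _ _ ⟨
          suc l · (suc m · y) + ⟦ t ⟧ u + - ⟦ t ⟧ u         ≈⟨ +-cong (+-cong refl eq) refl ⟩
          suc l · (suc m · y) + suc l · b + - ⟦ t ⟧ u       ≈⟨ +-cong (·-distrib-+ (suc m · y) b (suc l)) (eval-⊖ u t) ⟨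
          suc l · (suc m · y + b) + ⟦ ⊖ t ⟧ u               ≈⟨ +-cong (·-cong (suc l) (proj₂ value)) refl ⟩
          suc l · integer z + ⟦ ⊖ t ⟧ u                     ≈⟨ +-cong (·-cong (suc l) (eval-numeral u z)) refl ⟨
          suc l · ⟦ numeral z ⟧ u + ⟦ ⊖ t ⟧ u               ≈⟨ eval-⊙⊕ u (suc l) (numeral z) (⊖ t) ⟨
          ⟦ suc l ⊙ numeral z ⊕ ⊖ t ⟧ u                     ∎)
        where
        my+b : suc m · y + b ≈ (suc m ℕ.* suc k) · w + (suc m · (s · 1#) + b)
        my+b = begin
          suc m · y + b                                         ≈⟨ +-cong (·-cong (suc m) y≈) refl ⟩
          suc m · (suc k · w + s · 1#) + b                      ≈⟨ +-cong (·-distrib-+ _ _ (suc m)) refl ⟩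
          suc m · (suc k · w) + suc m · (s · 1#) + b            ≈⟨ +-cong (+-cong (·-assocˡ w (suc m) (suc k)) refl) refl ⟩
          (suc m ℕ.* suc k) · w + suc m · (s · 1#) + b          ≈⟨ +-assoc _ _ _ ⟩
          (suc m ℕ.* suc k) · w + (suc m · (s · 1#) + b)        ∎
        value : ∃[ z ] suc m · y + b ≈ integer z
        value = finite _ p (Holds-resp (multiple k) (sym my+b)
          (from (multiple-+ k w _ (n∣m*n (suc m))) (reflected-divisible k s i l t (suc m) eq eq′ k∣)))
        z = proj₁ value

      literals : Bool → List Requirement → List (ℕ × Carrier)
      literals σ     []ᴸ                           = []ᴸ
      literals true  (literal true m b ∷ᴸ ρs)      = (m , b) ∷ᴸ literals true ρs
      literals false (literal false m b ∷ᴸ ρs)     = (m , b) ∷ᴸ literals false ρs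
      literals σ     (_ ∷ᴸ ρs)                     = literals σ ρs

      avoided : List Requirement → List Carrier
      avoided []ᴸ              = []ᴸ
      avoided (avoid g ∷ᴸ ρs)  = g ∷ᴸ avoided ρs
      avoided (_ ∷ᴸ ρs)        = avoided ρs

      literals-reflected : ∀ σ {ρs} → All Admissible ρs → All (Reflected σ) (literals σ ρs)
      literals-reflected σ     []ᴸ = []ᴸ
      literals-reflected true  {literal true m b ∷ᴸ _}  (h ∷ᴸ hs) = h ∷ᴸ literals-reflected true hs
      literals-reflected false {literal false m b ∷ᴸ _} (h ∷ᴸ hs) = h ∷ᴸ literals-reflected false hs
      literals-reflected true  {literal false m b ∷ᴸ _} (_ ∷ᴸ hs) = literals-reflected true hs
      literals-reflected false {literal true m b ∷ᴸ _}  (_ ∷ᴸ hs) = literals-reflected false hs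
      literals-reflected true  {none ∷ᴸ _}              (_ ∷ᴸ hs) = literals-reflected true hs
      literals-reflected false {none ∷ᴸ _}              (_ ∷ᴸ hs) = literals-reflected false hs
      literals-reflected true  {avoid _ ∷ᴸ _}           (_ ∷ᴸ hs) = literals-reflected true hs
      literals-reflected false {avoid _ ∷ᴸ _}           (_ ∷ᴸ hs) = literals-reflected false hs

      satisfies-all : ∀ y′ ρs → All (λ g → ¬ y′ ≈ g) (avoided ρs) →
        All (λ (m , b) → InP (suc m · y′ + b)) (literals true ρs) →
        All (λ (m , b) → ¬ InP (suc m · y′ + b)) (literals false ρs) → All (Satisfies y′) ρs
      satisfies-all y′ []ᴸ _ _ _ = []ᴸ
      satisfies-all y′ (none ∷ᴸ ρs) as ps ns = tt ∷ᴸ satisfies-all y′ ρs as ps ns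
      satisfies-all y′ (avoid g ∷ᴸ ρs) (a ∷ᴸ as) ps ns = a ∷ᴸ satisfies-all y′ ρs as ps ns
      satisfies-all y′ (literal true m b ∷ᴸ ρs) as (p ∷ᴸ ps) ns = p ∷ᴸ satisfies-all y′ ρs as ps ns
      satisfies-all y′ (literal false m b ∷ᴸ ρs) as ps (n ∷ᴸ ns) = n ∷ᴸ satisfies-all y′ ρs as ps ns

      satisfiable : ∀ ρs → All Admissible ρs → ∃[ y′ ] All (Satisfies y′) ρs
      satisfiable ρs hs
        with random (proj₁ ∘ lookup ps) (proj₁ ∘ lookup ns) (proj₂ ∘ lookup ps) (proj₂ ∘ lookup ns)
               (lookup (avoided ρs)) (λ i j → distinct (reflected true i) (reflected false j))
        where
        ps = literals true ρs
        ns = literals false ρs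
        reflected : ∀ σ i → Reflected σ (lookup (literals σ ρs) i)
        reflected σ i = All.lookup (literals-reflected σ hs) (∈-lookup i)
      ... | inj₁ (y′ , as , ps , ns) =
        y′ , satisfies-all y′ ρs (lookup⁻ _ as) (lookup⁻ _ ps) (lookup⁻ _ ns)
      ... | inj₂ (k , finite , covers) =
        -- The covering is read at the residue of y, since positive literals are known to hold for y
        -- with the original b.
        let s , s<k , w , y≈ = division k y
            i , k∣           = covers s s<k
        in contradiction k∣
             (not-covered k finite s w y≈ (proj₁ (lookup (literals true ρs) i))
               (All.lookup (literals-reflected true hs) (∈-lookup i)))

    -- Writing c = (L + 1) y + j for a common multiple L + 1 of the moduli
    -- involved, all divisions become exact and only conditions on y remain.
    module _ (saturated : ℵ₁-Saturated U) (c : Carrier) (c-transcendental : Transcendental c u) where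

      Literal : Set
      Literal = ℕ × Bool × Kind × Term 𝓛ₚ (suc n)

      kind : Literal → Kind
      kind (_ , _ , κ , _) = κ

      literal-formula : Literal → Formula 𝓛ₚ (suc n)
      literal-formula (_ , true  , κ , t) = basic κ t
      literal-formula (_ , false , κ , t) = not (basic κ t)

      True : Pred Literal ℓ
      True (_ , σ , κ , t) = Signed σ (Holds κ (⟦ t ⟧ (c ∷ u)))

      Realizes : Carrier → Pred Literal ℓ
      Realizes x θ = U ⊨ literal-formula θ [ x ∷ v (proj₁ θ) ]

      realizes : ∀ x i σ κ t → Signed σ (Holds κ (⟦ t ⟧ (x ∷ v i))) ⇔ Realizes x (i , σ , κ , t)
      realizes x i true  κ t = ⇔-sym (⊨-basic κ t (x ∷ v i))
      realizes x i false κ t = mk⇔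
        (λ ¬h → from (⊨-not U (basic κ t)) (¬h ∘ to (⊨-basic κ t (x ∷ v i))))
        (λ h → to (⊨-not U (basic κ t)) h ∘ from (⊨-basic κ t (x ∷ v i)))

      module _ (L j : ℕ) (y : Carrier) (c≈ : c ≈ suc L · y + j · 1#) where

        y-transcendental : Transcendental y u
        y-transcendental k t eq = c-transcendental k (suc L ⊙ t ⊕ suc k ⊙ (j ⊙ 𝟙)) (begin
          suc k · c                                  ≈⟨ ·-cong (suc k) c≈ ⟩
          suc k · (suc L · y + j · 1#)               ≈⟨ ·-distrib-+ _ _ (suc k) ⟩
          suc k · (suc L · y) + suc k · (j · 1#)
            ≈⟨ +-cong (·-comm (suc k) (suc L) y) (·-cong (suc k) (sym (eval-⊙𝟙 u j))) ⟩
          suc L · (suc k · y) + suc k · ⟦ j ⊙ 𝟙 ⟧ u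
            ≈⟨ +-cong (·-cong (suc L) eq) (sym (eval-⊙ u (suc k) (j ⊙ 𝟙))) ⟩
          suc L · ⟦ t ⟧ u + ⟦ suc k ⊙ (j ⊙ 𝟙) ⟧ u    ≈⟨ eval-⊙⊕ u (suc L) t (suc k ⊙ (j ⊙ 𝟙)) ⟨
          ⟦ suc L ⊙ t ⊕ suc k ⊙ (j ⊙ 𝟙) ⟧ u          ∎)

        substitute : ∀ k (s : Term 𝓛ₚ n) x w → k · (suc L · x + j · 1#) + ⟦ s ⟧ w ≈
                                 (k ℕ.* suc L) · x + ⟦ k ⊙ (j ⊙ 𝟙) ⊕ s ⟧ w
        substitute k s x w = begin
          k · (suc L · x + j · 1#) + ⟦ s ⟧ w                ≈⟨ +-cong (·-distrib-+ _ _ k) refl ⟩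
          k · (suc L · x) + k · (j · 1#) + ⟦ s ⟧ w          ≈⟨ +-assoc _ _ _ ⟩
          k · (suc L · x) + (k · (j · 1#) + ⟦ s ⟧ w)
            ≈⟨ +-cong (·-assocˡ x k (suc L)) (+-cong (·-cong k (sym (eval-⊙𝟙 w j))) refl) ⟩
          (k ℕ.* suc L) · x + (k · ⟦ j ⊙ 𝟙 ⟧ w + ⟦ s ⟧ w)   ≈⟨ +-cong refl (eval-⊙⊕ w k (j ⊙ 𝟙) s) ⟨
          (k ℕ.* suc L) · x + ⟦ k ⊙ (j ⊙ 𝟙) ⊕ s ⟧ w         ∎

        reduce-literal : ∀ θ → suc (modulus-1 (kind θ)) ∣ suc L → True θ →
          ∃[ ρ ] (Admissible y y-transcendental ρ ×
                  (∀ y′ → Satisfies y′ ρ → Realizes (suc L · y′ + j · 1#) θ))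
        reduce-literal (i , σ , κ , t) κ∣L h =
          let k , s , normal = normal-form κ t
              change = λ x w → Holds-cong κ (substitute k s x w) ⇔-∘ normal (suc L · x + j · 1#) w
              ρ , admissible , sufficient = reduce y y-transcendental i σ κ (k ℕ.* suc L) (k ⊙ (j ⊙ 𝟙) ⊕ s)
                (∣n⇒∣m*n k κ∣L)
                (Signed-⇔ σ (change y u ⇔-∘ Holds-cong κ (eval-cong U (∷-cong U c≈ (λ _ → refl)) t)) h)
          in ρ , admissible , λ y′ satisfied → to (realizes _ i σ κ t)
               (Signed-⇔ σ (⇔-sym (change y′ (v i))) (sufficient y′ satisfied))

        reduce-literals : ∀ {θs} → All (λ θ → suc (modulus-1 (kind θ)) ∣ suc L) θs → All True θs →
          ∃[ ρs ] (All (Admissible y y-transcendental) ρs ×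
                   (∀ y′ → All (Satisfies y′) ρs → All (Realizes (suc L · y′ + j · 1#)) θs))
        reduce-literals {[]ᴸ} []ᴸ []ᴸ = []ᴸ , []ᴸ , λ _ _ → []ᴸ
        reduce-literals {θ ∷ᴸ _} (d ∷ᴸ ds) (h ∷ᴸ hs) =
          let ρ , a , f    = reduce-literal θ d h
              ρs , as , fs = reduce-literals ds hs
          in ρ ∷ᴸ ρs , a ∷ᴸ as , λ { y′ (x ∷ᴸ xs) → f y′ x ∷ᴸ fs y′ xs }

      finitely-satisfiable : ∀ θs → All True θs → ∃[ x ] All (Realizes x) θs
      finitely-satisfiable θs hs =
        let L , ds           = common-multiple (modulus-1 ∘ kind) θs
            j , _ , y , c≈   = division L c
            ρs , as , fs     = reduce-literals L j y c≈ ds hs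
            y′ , satisfied   = satisfiable y (y-transcendental L j y c≈) ρs as
        in suc L · y′ + j · 1# , fs y′ satisfied

      -- The realized type contains every condition with the sign it has at c, so truth and falsity
      -- both carry over, for all i at once.
      extend : ∃[ c′ ] (∀ i → c ∷ u ∼ c′ ∷ v i)
      extend =
        let c′ , h = saturated-family U saturated v proj₁ literal-formula True finitely-satisfiable c
        in c′ , λ i κ t → mk⇔
             (λ x → from (realizes c′ i true κ t) (h (i , true , κ , t) x))
             (λ x → by-contradiction λ ¬x → from (realizes c′ i false κ t) (h (i , false , κ , t) ¬x) x)

  -- Multiplication by k + 1 replaces c by its term, so conditions on an element of the divisible
  -- hull become conditions on u.
  algebraic-value : ∀ {k t c} {u : Env n} → suc k · c ≈ ⟦ t ⟧ u → ∀ κ l s →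
    Holds κ (l · c + ⟦ s ⟧ u) ⇔ Holds (scale k κ) (⟦ l ⊙ t ⊕ suc k ⊙ s ⟧ u)
  algebraic-value {k = k} {t} {c} {u} eq κ l s = Holds-cong (scale k κ) (begin
    suc k · (l · c + ⟦ s ⟧ u)              ≈⟨ ·-distrib-+ _ _ (suc k) ⟩
    suc k · (l · c) + suc k · ⟦ s ⟧ u      ≈⟨ +-cong (·-comm (suc k) l c) (sym (eval-⊙ u (suc k) s)) ⟩
    l · (suc k · c) + ⟦ suc k ⊙ s ⟧ u      ≈⟨ +-cong (·-cong l eq) refl ⟩
    l · ⟦ t ⟧ u + ⟦ suc k ⊙ s ⟧ u          ≈⟨ eval-⊙⊕ u l t (suc k ⊙ s) ⟨
    ⟦ l ⊙ t ⊕ suc k ⊙ s ⟧ u                ∎) ⇔-∘ Holds-scale k κ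

  -- Preservation of formulas, generic solutions, indiscernibles

  module Saturated (saturated : ℵ₁-Saturated U) where

    -- A transcendental c is the case of a constant sequence, for which coherence is the
    -- preservation of equations from w back to u. Otherwise k + 1 divides t at u, hence also at w,
    -- and the quotient there is the partner of c.
    forth : {u w : Env n} → u ∼ w → ∀ c → ∃[ c′ ] c ∷ u ∼ c′ ∷ w
    forth {u = u} {w} u∼w c with em {P = ∃[ k ] ∃[ t ] suc k · c ≈ ⟦ t ⟧ u}
    ... | no c∉acl =
      let c′ , h = Extension.extend u (λ _ → w) (λ _ → u∼w) (λ _ _ → ∼-equal (∼-sym u∼w))
                     saturated c (λ k t eq → c∉acl (k , t , eq))
      in c′ , h 0
    ... | yes (k , t , eq) =
      let c′ , eq′ = to (u∼w (multiple k) t) (c , sym eq)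
      in c′ , λ κ t′ →
        let l , s , normal = normal-form κ t′
        in ⇔-sym (normal c′ w) ⇔-∘ (⇔-sym (algebraic-value (sym eq′) κ l s) ⇔-∘
           (u∼w (scale k κ) (l ⊙ t ⊕ suc k ⊙ s) ⇔-∘ (algebraic-value eq κ l s ⇔-∘ normal c u)))

    InP⇔ : ∀ {x} → InP x ⇔ Holds (multipleOfP 0) x
    InP⇔ {x} = mk⇔
      (λ p → x , sym (+-identityʳ x) , p)
      (λ (z , eq , p) → InP-cong (sym (trans eq (+-identityʳ z))) p)

    congruent⇔ : ∀ {k} (j : Fin (suc k)) (t : Term 𝓛ₚ n) v → holds (base (congᴿ (suc k) j)) (⟦ t ⟧ v ∷ []) ⇔
                 Holds (multiple k) (⟦ t ⊕ ⊖ (toℕ j ⊙ 𝟙) ⟧ v)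
    congruent⇔ {k = k} j t v = mk⇔
      (λ (y , eq) → y , trans value (+-cancelʳ j1 _ _ (trans cancel eq)))
      (λ (y , eq) → y , trans (sym cancel) (+-cong (trans (sym value) eq) refl))
      ⇔-∘ congruence j (⟦ t ⟧ v)
      where
      j1 = toℕ j · 1#
      value : ⟦ t ⊕ ⊖ (toℕ j ⊙ 𝟙) ⟧ v ≈ ⟦ t ⟧ v + - j1
      value = trans (eval-⊕ v t _) (+-cong refl (trans (eval-⊖ v _) (neg-cong (eval-⊙𝟙 v (toℕ j)))))
      cancel : ⟦ t ⟧ v + - j1 + j1 ≈ ⟦ t ⟧ v
      cancel = trans (+-assoc _ _ _) (trans (+-cong refl (+-inverseˡ j1)) (+-identityʳ _))

    ∼⇒⊨ : {u w : Env n} → u ∼ w → ∀ φ → U ⊨ φ [ u ] → U ⊨ φ [ w ]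
    ∼⇒⊨ u∼w (equal s t) = ∼-equal u∼w s t
    -- Modulus 0 does not arise, because `Fin 0` has no residue j.
    ∼⇒⊨ {u = u} {w} u∼w (rel (base (congᴿ (suc k) j)) ts) =
      holds-cong (base (congᴿ (suc k) j)) (λ { zero → refl }) ∘
      from (congruent⇔ j (ts zero) w) ∘ to (u∼w (multiple k) (ts zero ⊕ ⊖ (toℕ j ⊙ 𝟙))) ∘
      to (congruent⇔ j (ts zero) u) ∘
      holds-cong (base (congᴿ (suc k) j)) (λ { zero → refl })
    ∼⇒⊨ u∼w (rel P ts) =
      holds-cong P (λ { zero → refl }) ∘
      from InP⇔ ∘ to (u∼w (multipleOfP 0) (ts zero)) ∘ to InP⇔ ∘
      holds-cong P (λ { zero → refl })
    ∼⇒⊨ u∼w false = id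
    ∼⇒⊨ u∼w (imp φ ψ) h = ∼⇒⊨ u∼w ψ ∘ h ∘ ∼⇒⊨ (∼-sym u∼w) φ
    -- Here c lives on the side of w, so `forth` runs backwards to find a partner on the side of u,
    -- where h can be used.
    ∼⇒⊨ u∼w (all φ) h c = let c′ , c∼c′ = forth (∼-sym u∼w) c in ∼⇒⊨ (∼-sym c∼c′) φ (h c′)

    -- `nothing` will index the formula φ itself and adds only a harmless `0#` to the list of
    -- excluded elements.
    root-of : Maybe (ℕ × Term 𝓛ₚ n) → Env n → Carrier
    root-of nothing        u = 0#
    root-of (just (k , t)) u = proj₁ (root k (⟦ t ⟧ u))

    -- Each equation (k + 1) x = t excludes at most one element, so finitely many cannot exhaust the
    -- infinitely many solutions of φ; saturation then avoids all equations together.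
    transcendental-solution : (φ : Formula 𝓛ₚ (suc n)) (u : Env n) → ¬ Algebraic U φ u →
                              ∃[ c ] (U ⊨ φ [ c ∷ u ] × Transcendental c u)
    transcendental-solution {n = n} φ u infinite =
      let c , h = saturated-family U saturated (λ _ → u) (λ _ → 0) θ (λ _ → ⊤) finitely-satisfiable 0#
      in c , h nothing tt , λ k t eq →
           to (⊨-not U (equation k t)) (h (just (k , t)) tt) (from (⊨-equation k t c) eq)
      where
      equation : ℕ → Term 𝓛ₚ n → Formula 𝓛ₚ (suc n)
      equation k t = equal (suc k ⊙ var zero) (rename suc t)

      θ : Maybe (ℕ × Term 𝓛ₚ n) → Formula 𝓛ₚ (suc n)
      θ nothing        = φ
      θ (just (k , t)) = not (equation k t)

      ⊨-equation : ∀ k t c → U ⊨ equation k t [ c ∷ u ] ⇔ suc k · c ≈ ⟦ t ⟧ u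
      ⊨-equation k t c = mk⇔
        (λ eq → trans (sym (eval-⊙ (c ∷ u) (suc k) (var zero))) (trans eq (eval-rename U suc (c ∷ u) t)))
        (λ eq → trans (eval-⊙ (c ∷ u) (suc k) (var zero)) (trans eq (sym (eval-rename U suc (c ∷ u) t))))

      avoids-roots : ∀ {c} → U ⊨ φ [ c ∷ u ] → ∀ is → ¬ Any (c ≈_) (map (λ i → root-of i u) is) →
                     All (λ i → U ⊨ θ i [ c ∷ u ]) is
      avoids-roots c∈φ []ᴸ c∉ = []ᴸ
      avoids-roots c∈φ (nothing ∷ᴸ is) c∉ = c∈φ ∷ᴸ avoids-roots c∈φ is (c∉ ∘ there)
      avoids-roots {c} c∈φ (just (k , t) ∷ᴸ is) c∉ =
        from (⊨-not U (equation k t)) (λ eq → c∉ (here (proj₂ (root k (⟦ t ⟧ u)) c (to (⊨-equation k t c) eq))))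
        ∷ᴸ avoids-roots c∈φ is (c∉ ∘ there)

      finitely-satisfiable : ∀ is → All (λ _ → ⊤) is → ∃[ c ] All (λ i → U ⊨ θ i [ c ∷ u ]) is
      finitely-satisfiable is _ = by-contradiction λ unsatisfiable → infinite
        (map (λ i → root-of i u) is , λ c c∈φ → by-contradiction λ c∉ →
          unsatisfiable (c , avoids-roots c∈φ is c∉))

    module _ (B : Pred Carrier ℓ) (a : ℕ → Env n) (indiscernible : Indiscernible U B a) where

      -- The place of coordinate x of the s-th tuple in the concatenation; the summand 0 is an empty
      -- block of parameters.
      position : Fin k → Fin n → Fin (k ℕ.* n ℕ.+ 0)
      position s x = combine s x ↑ˡ 0

      eval-position : (is : Vector ℕ k) (s : Fin k) (t : Term 𝓛ₚ n) →
        ⟦ rename (position s) t ⟧ (concat (a ∘ is) ++ []) ≈ ⟦ t ⟧ (a (is s))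
      eval-position is s t = trans (eval-rename U (position s) _ t) (eval-cong U (λ x → reflexive (≡.trans
        (lookup-++ˡ (concat (a ∘ is)) [] (combine s x))
        (≡.cong (λ (i , j) → a (is i) j) (remQuot-combine s x)))) t)

      indiscernible-∼ : ∀ i j → a i ∼ a j
      indiscernible-∼ i j κ t =
        at j ⇔-∘ (indiscernible (basic κ t′) [] (λ ()) (λ _ → i) (λ _ → j)
                    (λ { {zero} {zero} () }) (λ { {zero} {zero} () })
        ⇔-∘ ⇔-sym (at i))
        where
        t′ = rename (position {k = 1} zero) t
        at : ∀ i → U ⊨ basic κ t′ [ concat (a ∘ (λ (_ : Fin 1) → i)) ++ [] ] ⇔ Holds κ (⟦ t ⟧ (a i))
        at i = Holds-cong κ (eval-position (λ _ → i) zero t) ⇔-∘ ⊨-basic κ t′ _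

      increasing : ∀ {i j} → i ℕ.< j → StrictlyIncreasing (i ∷ j ∷ [])
      increasing i<j {zero}     {zero}     ()
      increasing i<j {zero}     {suc zero} _ = i<j
      increasing i<j {suc zero} {zero}     ()
      increasing i<j {suc zero} {suc zero} (ℕ.s≤s ())

      indiscernible-equal : ∀ {i j i′ j′} → i ℕ.< j → i′ ℕ.< j′ → ∀ s t →
        ⟦ s ⟧ (a i) ≈ ⟦ t ⟧ (a j) → ⟦ s ⟧ (a i′) ≈ ⟦ t ⟧ (a j′)
      indiscernible-equal {i} {j} {i′} {j′} i<j i′<j′ s t =
        to (at i′ j′) ∘
        to (indiscernible (equal s′ t′) [] (λ ()) (i ∷ j ∷ []) (i′ ∷ j′ ∷ [])
                          (increasing i<j) (increasing i′<j′)) ∘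
        from (at i j)
        where
        s′ = rename (position {k = 2} zero) s
        t′ = rename (position {k = 2} (suc zero)) t
        at : ∀ i j → U ⊨ equal s′ t′ [ concat (a ∘ (i ∷ j ∷ [])) ++ [] ] ⇔ ⟦ s ⟧ (a i) ≈ ⟦ t ⟧ (a j)
        at i j = mk⇔
          (λ eq → trans (sym s≈) (trans eq t≈))
          (λ eq → trans s≈ (trans eq (sym t≈)))
          where
          s≈ = eval-position (i ∷ j ∷ []) zero s
          t≈ = eval-position (i ∷ j ∷ []) (suc zero) t

      -- One equation between two places gives it for every increasing pair. The pairs (1, 2), (0,
      -- 2) and (0, 1) form a chain that joins s to t at the single place 1, and `indiscernible-∼`
      -- moves the result to 0.
      coherent-< : ∀ {i j} → i ℕ.< j → ∀ s t → ⟦ s ⟧ (a i) ≈ ⟦ t ⟧ (a j) → ⟦ s ⟧ (a 0) ≈ ⟦ t ⟧ (a 0)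
      coherent-< i<j s t eq = ∼-equal (indiscernible-∼ 1 0) s t (begin
        ⟦ s ⟧ (a 1)  ≈⟨ indiscernible-equal i<j (ℕ.s≤s (ℕ.s≤s ℕ.z≤n)) s t eq ⟩
        ⟦ t ⟧ (a 2)  ≈⟨ indiscernible-equal i<j (ℕ.s≤s ℕ.z≤n) s t eq ⟨
        ⟦ s ⟧ (a 0)  ≈⟨ indiscernible-equal i<j (ℕ.s≤s ℕ.z≤n) s t eq ⟩
        ⟦ t ⟧ (a 1)  ∎)

      coherent : ∀ i j s t → ⟦ s ⟧ (a i) ≈ ⟦ t ⟧ (a j) → ⟦ s ⟧ (a 0) ≈ ⟦ t ⟧ (a 0)
      coherent i j s t eq with ℕ.<-cmp i j
      ... | tri< i<j _ _    = coherent-< i<j s t eq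
      ... | tri≈ _ ≡.refl _ = ∼-equal (indiscernible-∼ i 0) s t eq
      ... | tri> _ _ j<i    = sym (coherent-< j<i t s (sym eq))

      non-algebraic⇒consistent : ∀ φ → ¬ Algebraic U φ (a 0) → ∃[ c ] (∀ i → U ⊨ φ [ c ∷ a i ])
      non-algebraic⇒consistent φ infinite =
        let c , c∈φ , transcendental = transcendental-solution φ (a 0) infinite
            c′ , c∼c′ = Extension.extend (a 0) a (indiscernible-∼ 0) coherent saturated c transcendental
        in c′ , λ i → ∼⇒⊨ (c∼c′ i) φ c∈φ

theorem3p3 : ∀ {ℓ ℓ′} → (∀ {a} → ExcludedMiddle a) →
    (M : Structure 𝓛 ℓ) (ι : ElementaryEmbedding 𝒵 M)
    (D : Pred (Structure.Carrier M) ℓ) (D-resp : D Respects (Structure._≈_ M)) →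
    AdditivelyRandom M ι D → SymmetricSubset M D →
    SupersimpleOfRank1 ℓ′ (Th (expand M D D-resp))
theorem3p3 em M ι D D-resp additively-random symmetric U U⊨Th saturated φ ā B
           (a , indiscernible , a₀≈ā , inconsistent) =
  by-contradiction λ infinite → inconsistent (non-algebraic⇒consistent B a indiscernible φ
    -- The sequence starts at ā only up to pointwise ≈, so a finite list for `a 0` is carried over
    -- to ā.
    λ (cs , finite) → infinite (cs , λ c c∈φ → finite c
      (⊨-cong U (∷-cong U U.refl (λ t → U.sym (a₀≈ā t))) φ c∈φ)))
  where
  module U = Arithmetic U
  open Classical em
  open Models em M ι D D-resp additively-random symmetric U U⊨Th
  open RandomGroup em U isRandomGroup
  open Saturated saturated
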